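{- Let $k,m\ge 1$ be integers. Every $k$-connected graph $G$ with at least $2m$ vertices contains a $k$-removable $m$-matching if \[ \delta(G)\ \ge\ \begin{cases} \max\bigl\{k+\bigl\lceil\tfrac m2\bigr\rceil,\ 2m\bigr\} & \text{if } k\ge m,\\ k+m & \text{if } k<m. \end{cases} \]
   Context: All graphs are finite, undirected and simple. $\delta(G)$ denotes the minimum degree of $G$. A graph is $k$-connected if it has at least $k+1$ vertices and deleting any set of at most $k-1$ vertices leaves a connected graph. For $F\subseteq E(G)$, $G-F$ is the graph obtained from $G$ by deleting the edges in $F$ (keeping all vertices). A matching is a set of pairwise disjoint edges; an $m$-matching is a matching consisting of exactly $m$ edges. A matching $M$ of a $k$-connected graph $G$ is $k$-removable if $G-M$ is $k$-connected. -}

module Defs where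

open import Data.Fin using (Fin; _≟_)
open import Data.Fin.Subset using (Subset; _∈_; ∁; ∣_∣)
open import Data.List using (List; length; map; allFin)
open import Data.List.Extrema.Nat using (min)
open import Data.List.Relation.Unary.AllPairs using (AllPairs)
open import Data.List.Relation.Unary.Any as Any using (Any)
open import Data.Nat using (ℕ; _<_)
open import Data.Product using (∃; _×_; _,_; proj₁)
open import Data.Sum as Sum using (_⊎_)
open import Data.Vec using (tabulate)
open import Function using (_∘_)
open import Relation.Binary.Construct.Closure.ReflexiveTransitive using (Star)
open import Relation.Binary.Definitions using (Decidable; Symmetric; Irreflexive)
open import Relation.Binary.PropositionalEquality using (_≡_; refl)
open import Relation.Nullary using (¬_; Dec; does)
open import Relation.Nullary.Decidable using (_×-dec_; _⊎-dec_; ¬?)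

-- Simple graphs.  Finite graphs are those of type Graph (Fin n); the vertex
-- type is left general so that induced subgraphs need no renumbering.
record Graph (V : Set) : Set₁ where
  field
    Adj    : V → V → Set
    adj?   : Decidable Adj
    sym    : Symmetric Adj
    irrefl : Irreflexive _≡_ Adj

open Graph public

Connected : {V : Set} → Graph V → Set
Connected {V} G = (u v : V) → Star (Adj G) u v

module _ {n : ℕ} where

  deleteVertices : Graph (Fin n) → (S : Subset n) → Graph (∃ λ v → v ∈ ∁ S)
  deleteVertices G S = record
    { Adj    = λ u v → Adj G (proj₁ u) (proj₁ v)
    ; adj?   = λ u v → adj? G (proj₁ u) (proj₁ v)
    ; sym    = sym G
    ; irrefl = λ { refl → irrefl G refl }
    }

  -- Meant for k ≥ 1, where ∣ S ∣ < k says that S has at most k - 1 elements.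
  IsKConnected : ℕ → Graph (Fin n) → Set
  IsKConnected k G =
    k < n × (∀ (S : Subset n) → ∣ S ∣ < k → Connected (deleteVertices G S))

  degree : Graph (Fin n) → Fin n → ℕ
  degree G u = ∣ tabulate (λ v → does (adj? G u v)) ∣

  -- Every degree is less than n, so the default value n passed to min is
  -- attained only by the graph without vertices.
  δ : Graph (Fin n) → ℕ
  δ G = min n (map (degree G) (allFin n))

  -- An edge is stored with an arbitrary orientation; Joins and Disjoint
  -- do not depend on it.
  record Edge (G : Graph (Fin n)) : Set where
    constructor edge
    field
      src tgt  : Fin n
      adjacent : Adj G src tgt

  open Edge public

  Joins : {G : Graph (Fin n)} → Fin n → Fin n → Edge G → Set
  Joins u v e = (src e ≡ u × tgt e ≡ v) ⊎ (src e ≡ v × tgt e ≡ u)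

  _∈ᵉ_ : {G : Graph (Fin n)} → Fin n → Edge G → Set
  v ∈ᵉ e = v ≡ src e ⊎ v ≡ tgt e

  Disjoint : {G : Graph (Fin n)} → Edge G → Edge G → Set
  Disjoint e f = ∀ v → ¬ (v ∈ᵉ e × v ∈ᵉ f)

  deleteEdges : (G : Graph (Fin n)) → List (Edge G) → Graph (Fin n)
  deleteEdges G F = record
    { Adj    = λ u v → Adj G u v × ¬ Any (Joins u v) F
    ; adj?   = λ u v → adj? G u v ×-dec ¬? (Any.any? (joins? u v) F)
    ; sym    = λ { (a , ¬j) → sym G a , ¬j ∘ Any.map Sum.swap }
    ; irrefl = λ { eq (a , _) → irrefl G eq a }
    }
    where
    joins? : ∀ u v (e : Edge G) → Dec (Joins u v e)
    joins? u v e = (src e ≟ u ×-dec tgt e ≟ v) ⊎-dec (src e ≟ v ×-dec tgt e ≟ u)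

  -- Pairwise disjoint edges are in particular distinct, so a list of them
  -- has no repetitions and its length is the number of edges.
  IsMatching : {G : Graph (Fin n)} → ℕ → List (Edge G) → Set
  IsMatching m M = AllPairs Disjoint M × length M ≡ m

  IsRemovable : (k : ℕ) (G : Graph (Fin n)) → List (Edge G) → Set
  IsRemovable k G M = IsKConnected k (deleteEdges G M)

{-# OPTIONS --safe #-}

-- A matching M of fewer than m edges with H = G - M k-connected can always be enlarged.  Let U
-- be the set of vertices not covered by M.  If no edge inside U extends M, then every such edge
-- is critical in H: together with fewer than k vertices it separates H.  By an uncrossing
-- argument of Mader, critical edges between vertices of degree > k form a forest, so some vertex
-- of U has at most one neighbour in U and hence degree at most 2|M| + 1.  This contradicts
-- δ ≥ 2m.  If instead δ ≥ k + m, counting neighbours of leaves on both sides of the separation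
-- belonging to a critical edge shows that U meets only one side; therefore U is independent,
-- and a further count shows that no edge at U is critical.  Two vertices u₁, u₂ of U send at
-- least 2(k + m) > 2|M| edges to M, so some xy in M receives three of them, say u₁x, u₂y and
-- one more, and replacing xy by u₁x and u₂y gives a larger matching, still removable because a
-- separation destroying it would make u₁x or u₂y critical.

module Submission where

open import Defs
import Algebra.Properties.CommutativeMonoid.Sum
open import Data.Bool using (true; false; if_then_else_)
open import Data.Empty using (⊥; ⊥-elim)
open import Data.Fin using (Fin; zero; suc; _≟_; funToFin; finToFun)
open import Data.Fin.Properties using (any?; all?; finToFun-funToFin)
open import Data.Fin.Subset using (Subset; _∈_; ∁; ∣_∣)
open import Data.Fin.Subset.Properties using (_∈?_; x∈∁p⇒x∉p; x∉p⇒x∈∁p)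
open import Data.List using (List; []; _∷_; length; map; allFin)
open import Data.List.Extrema.Nat using (min≤xs)
open import Data.List.Membership.Propositional.Properties using (∈-map⁺; ∈-allFin)
open import Data.List.Relation.Binary.Permutation.Propositional using (_↭_; ↭-refl; ↭-sym; ↭-trans; prep; swap)
open import Data.List.Relation.Binary.Permutation.Propositional.Properties using (Any-resp-↭; All-resp-↭; ↭-length)
open import Data.List.Relation.Unary.All as All using (All; []; _∷_)
open import Data.List.Relation.Unary.AllPairs using (AllPairs; []; _∷_)
open import Data.List.Relation.Unary.Any as Any using (Any; here; there)
open import Data.Nat as ℕ
  using (ℕ; zero; suc; _+_; _*_; _⊔_; _≤_; _<_; _≥_; z≤n; s≤s; s≤s⁻¹; _<?_; _≤?_; _≤ᵇ_; ⌈_/2⌉)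
open import Data.Nat.Induction using (<-wellFounded)
open import Data.Nat.Properties hiding (_≟_)
open import Data.Nat.Tactic.RingSolver using (solve-∀)
open import Data.Product using (∃; ∃₂; _×_; _,_; proj₁; proj₂)
open import Data.Sum as Sum using (_⊎_; inj₁; inj₂; [_,_]′)
open import Data.Vec using (tabulate; []; _∷_)
open import Data.Vec.Properties using (lookup∘tabulate; []=⇒lookup; lookup⇒[]=)
open import Data.Vec.Properties.WithK using ([]=-irrelevant)
open import Function using (_∘_; id)
open import Induction.WellFounded using (Acc; acc)
open import Relation.Binary.Construct.Closure.ReflexiveTransitive using (Star; ε; _◅_; _◅◅_)
open import Relation.Binary.Definitions using (Symmetric)
open import Relation.Binary.PropositionalEquality
  using (_≡_; _≢_; _≗_; refl; trans; cong; cong₂; subst; module ≡-Reasoning) renaming (sym to ≡-sym)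
open import Relation.Nullary using (¬_; Dec; yes; no; does)
open import Relation.Nullary.Decidable using (_×-dec_; _⊎-dec_; ¬?; map′; True; toWitness)

open Algebra.Properties.CommutativeMonoid.Sum +-0-commutativeMonoid using (sum; sum-cong-≗; ∑-distrib-+)

private variable
  n k : ℕ
  P : Set

-- Indicators and sums over the vertices.

𝟙 : Dec P → ℕ
𝟙 d = if does d then 1 else 0

1≤𝟙 : (d : Dec P) → P → 1 ≤ 𝟙 d
1≤𝟙 (yes _) p = ≤-refl
1≤𝟙 (no ¬p) p = ⊥-elim (¬p p)

𝟙≤ : (d : Dec P) {x : ℕ} → (P → 1 ≤ x) → 𝟙 d ≤ x
𝟙≤ (yes p) f = f p
𝟙≤ (no _)  f = z≤n

𝟙-no : (d : Dec P) → ¬ P → 𝟙 d ≡ 0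
𝟙-no (yes p) ¬p = ⊥-elim (¬p p)
𝟙-no (no _)  ¬p = refl

sum-mono : ∀ {n} {f g : Fin n → ℕ} → (∀ v → f v ≤ g v) → sum f ≤ sum g
sum-mono {zero}  f≤g = z≤n
sum-mono {suc n} f≤g = +-mono-≤ (f≤g zero) (sum-mono (f≤g ∘ suc))

sum-mono-< : ∀ {n} {f g : Fin n → ℕ} → (∀ v → f v ≤ g v) → ∀ u → f u < g u → sum f < sum g
sum-mono-< {suc n} f≤g zero    lt = +-mono-<-≤ lt (sum-mono (f≤g ∘ suc))
sum-mono-< {suc n} f≤g (suc u) lt = +-mono-≤-< (f≤g zero) (sum-mono-< (f≤g ∘ suc) u lt)

sum-0 : ∀ {n} {f : Fin n → ℕ} → (∀ v → f v ≡ 0) → sum f ≡ 0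
sum-0 {zero}  f≡0 = refl
sum-0 {suc n} f≡0 = cong₂ _+_ (f≡0 zero) (sum-0 (f≡0 ∘ suc))

sum-≟ : ∀ {n} (x : Fin n) → sum (λ v → 𝟙 (x ≟ v)) ≡ 1
sum-≟ {suc n} zero    = cong suc (sum-0 {n} λ v → refl)
sum-≟ {suc n} (suc x) = trans (sum-cong-≗ lem) (sum-≟ x)
  where
  lem : ∀ v → 𝟙 (suc x ≟ suc v) ≡ 𝟙 (x ≟ v)
  lem v with x ≟ v
  ... | yes _ = refl
  ... | no _  = refl

∣tabulate∣ : ∀ {n} {P : Fin n → Set} (P? : ∀ v → Dec (P v)) →
             ∣ tabulate (λ v → does (P? v)) ∣ ≡ sum (λ v → 𝟙 (P? v))
∣tabulate∣ {zero}  P? = refl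
∣tabulate∣ {suc n} P? with does (P? zero)
... | true  = cong suc (∣tabulate∣ (P? ∘ suc))
... | false = ∣tabulate∣ (P? ∘ suc)

degree-sum : (G : Graph (Fin n)) (u : Fin n) → degree G u ≡ sum (λ v → 𝟙 (adj? G u v))
degree-sum G u = ∣tabulate∣ (adj? G u)

-- Colourings as vertex separations.

-- A colouring records a vertex separation: two sides and the separator mid.  As Side is a
-- Fin, colourings can be enumerated with finToFun.
Side : Set
Side = Fin 3

pattern left  = zero
pattern mid   = suc zero
pattern right = suc (suc zero)

l≢r : ∀ {p : Side} → p ≡ left → p ≢ right
l≢r refl ()

l≢m : ∀ {p : Side} → p ≡ left → p ≢ mid
l≢m refl ()

r≢m : ∀ {p : Side} → p ≡ right → p ≢ mid
r≢m refl ()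

flip : Side → Side
flip left  = right
flip mid   = mid
flip right = left

-- If σ and τ describe separations A|S|B and C|T|D, then σ ∨ τ describes the one with sides A∩C and B∪D.
infixl 6 _∨_
_∨_ : Side → Side → Side
left ∨ q     = q
mid  ∨ right = right
mid  ∨ _     = mid
right ∨ _    = right

Colouring : ℕ → Set
Colouring n = Fin n → Side

# : Side → Colouring n → ℕ
# p σ = sum (λ v → 𝟙 (σ v ≟ p))

recolour : Fin n → Side → Colouring n → Colouring n
recolour x p σ v = if does (x ≟ v) then p else σ v

recolour-cases : ∀ (x : Fin n) p σ v → (x ≡ v × recolour x p σ v ≡ p) ⊎ (x ≢ v × recolour x p σ v ≡ σ v)
recolour-cases x p σ v with x ≟ v
... | yes e = inj₁ (e , refl)
... | no ¬e = inj₂ (¬e , refl)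

∨-left : ∀ p q → p ∨ q ≡ left → p ≡ left × q ≡ left
∨-left left q e = refl , e
∨-left mid left ()
∨-left mid mid ()
∨-left mid right ()
∨-left right _ ()

∨-right : ∀ p q → p ∨ q ≡ right → p ≡ right ⊎ q ≡ right
∨-right left  q     e = inj₂ e
∨-right mid   right e = inj₂ refl
∨-right right q     e = inj₁ refl

right-∨ : ∀ p q → p ≡ right → p ∨ q ≡ right
right-∨ _ q refl = refl

∨-right′ : ∀ p q → q ≡ right → p ∨ q ≡ right
∨-right′ left  _ refl = refl
∨-right′ mid   _ refl = refl
∨-right′ right _ refl = refl

flip-left : ∀ p → flip p ≡ left → p ≡ right
flip-left right _ = refl
flip-left left ()
flip-left mid ()

flip-right : ∀ p → flip p ≡ right → p ≡ left
flip-right left  _ = refl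
flip-right mid   ()
flip-right right ()

#mid-flip : (σ : Colouring n) → # mid (flip ∘ σ) ≡ # mid σ
#mid-flip σ = sum-cong-≗ λ v → lem (σ v)
  where
  lem : ∀ p → 𝟙 (flip p ≟ mid) ≡ 𝟙 (p ≟ mid)
  lem left  = refl
  lem mid   = refl
  lem right = refl

#left-flip : (σ : Colouring n) → # left (flip ∘ σ) ≡ # right σ
#left-flip σ = sum-cong-≗ λ v → lem (σ v)
  where
  lem : ∀ p → 𝟙 (flip p ≟ left) ≡ 𝟙 (p ≟ right)
  lem left  = refl
  lem mid   = refl
  lem right = refl

#mid-recolour : (x : Fin n) (σ : Colouring n) → # mid (recolour x mid σ) ≤ suc (# mid σ)
#mid-recolour x σ = begin
  # mid (recolour x mid σ)                            ≤⟨ sum-mono lem ⟩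
  sum (λ v → 𝟙 (x ≟ v) + 𝟙 (σ v ≟ mid))              ≡⟨ ∑-distrib-+ (λ v → 𝟙 (x ≟ v)) (λ v → 𝟙 (σ v ≟ mid)) ⟩
  sum (λ v → 𝟙 (x ≟ v)) + # mid σ                     ≡⟨ cong (_+ # mid σ) (sum-≟ x) ⟩
  suc (# mid σ) ∎
  where
  open ≤-Reasoning
  lem : ∀ v → 𝟙 (recolour x mid σ v ≟ mid) ≤ 𝟙 (x ≟ v) + 𝟙 (σ v ≟ mid)
  lem v with x ≟ v
  ... | yes _ = s≤s z≤n
  ... | no _  = ≤-refl

-- Separations of a graph and their decidability.

module _ {n : ℕ} (H : Graph (Fin n)) where

  Crosses : Colouring n → Fin n → Fin n → Set
  Crosses σ u v = σ u ≡ left × σ v ≡ right × Adj H u v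

  crosses? : ∀ σ u v → Dec (Crosses σ u v)
  crosses? σ u v = σ u ≟ left ×-dec σ v ≟ right ×-dec adj? H u v

  record Separation (k : ℕ) (σ : Colouring n) : Set where
    constructor separation
    field
      onLeft    : ∃ λ u → σ u ≡ left
      onRight   : ∃ λ v → σ v ≡ right
      small     : # mid σ < k
      separates : ∀ u v → ¬ Crosses σ u v

  Inseparable : ℕ → Set
  Inseparable k = ∀ σ → ¬ Separation k σ

  separation? : ∀ k σ → Dec (Separation k σ)
  separation? k σ =
    map′ (λ (l , r , s , c) → separation l r s c) (λ (separation l r s c) → l , r , s , c)
      (any? (λ u → σ u ≟ left) ×-dec any? (λ v → σ v ≟ right) ×-dec # mid σ <? k
        ×-dec all? λ u → all? λ v → ¬? (crosses? σ u v))

  -- Decoding an enumerated colouring returns the original only pointwise, so being a separation has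
  -- to be transported along pointwise equality.
  separation-resp : ∀ {σ τ} → σ ≗ τ → Separation k σ → Separation k τ
  separation-resp σ≗τ (separation (u , l) (v , r) s c) = separation
    (u , trans (≡-sym (σ≗τ u)) l) (v , trans (≡-sym (σ≗τ v)) r)
    (subst (_< _) (sum-cong-≗ λ w → cong (λ p → 𝟙 (p ≟ mid)) (σ≗τ w)) s)
    λ a b (al , br , e) → c a b (trans (σ≗τ a) al , trans (σ≗τ b) br , e)

  separable? : ∀ k → Dec (∃ (Separation k))
  separable? k with any? (λ i → separation? k (finToFun {3} {n} i))
  ... | yes (i , s) = yes (_ , s)
  ... | no ¬s = no λ (σ , s) → ¬s (funToFin σ , separation-resp (λ v → ≡-sym (finToFun-funToFin σ v)) s)


-- Connectivity as the absence of small separations.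

kConnected⇒inseparable : {G : Graph (Fin n)} → IsKConnected k G → Inseparable G k
kConnected⇒inseparable {n} {G = G} (_ , conn) σ (separation (x , xl) (y , yr) s c) =
  l≢r (stays xl (conn S (subst (_< _) (≡-sym (∣tabulate∣ mid?)) s) (x , x∉S) (y , y∉S))) yr
  where
  mid? : ∀ v → Dec (σ v ≡ mid)
  mid? v = σ v ≟ mid
  S : Subset n
  S = tabulate (λ v → does (mid? v))
  ∈S⇒mid : ∀ {v} → v ∈ S → σ v ≡ mid
  ∈S⇒mid {v} v∈S with mid? v | trans (≡-sym (lookup∘tabulate (λ v → does (mid? v)) v)) ([]=⇒lookup v∈S)
  ... | yes e | _ = e
  mid⇒∈S : ∀ {v} → σ v ≡ mid → v ∈ S
  mid⇒∈S {v} e = lookup⇒[]= v S (trans (lookup∘tabulate (λ v → does (mid? v)) v) (lem (mid? v)))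
    where
    lem : (d : Dec (σ v ≡ mid)) → does d ≡ true
    lem (yes _) = refl
    lem (no ¬e) = ⊥-elim (¬e e)
  x∉S : x ∈ ∁ S
  x∉S = x∉p⇒x∈∁p (l≢m xl ∘ ∈S⇒mid)
  y∉S : y ∈ ∁ S
  y∉S = x∉p⇒x∈∁p (r≢m yr ∘ ∈S⇒mid)
  -- A path that avoids S never meets the colour `mid`, and no edge leads from `left` to `right`, so
  -- a path that starts on the left cannot leave it.
  stays : ∀ {u v} → σ (proj₁ u) ≡ left → Star (Adj (deleteVertices G S)) u v → σ (proj₁ v) ≡ left
  stays ul ε = ul
  stays {u} ul (_◅_ {j = w} e es) = stays (step (σ (proj₁ w)) refl) es
    where
    step : ∀ p → σ (proj₁ w) ≡ p → σ (proj₁ w) ≡ left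
    step left  eq = eq
    step mid   eq = ⊥-elim (x∈∁p⇒x∉p (proj₂ w) (mid⇒∈S eq))
    step right eq = ⊥-elim (c _ _ (ul , eq , e))

∣∣-sum : ∀ {n} (S : Subset n) → ∣ S ∣ ≡ sum (λ v → 𝟙 (v ∈? S))
∣∣-sum []          = refl
∣∣-sum (true ∷ S)  = cong suc (∣∣-sum S)
∣∣-sum (false ∷ S) = ∣∣-sum S

-- Graph search from x with S as the separator: as long as y is unreached, the colouring is not a
-- separation, so some edge crosses it and its right end can be recoloured. The number of unreached
-- vertices decreases.
inseparable⇒kConnected : {G : Graph (Fin n)} → k < n → Inseparable G k → IsKConnected k G
inseparable⇒kConnected {n} {k} {G} k<n insep = k<n , conn
  where
  module _ (S : Subset n) (∣S∣<k : ∣ S ∣ < k) (x y : ∃ λ v → v ∈ ∁ S) where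

    _⇝_ = Star (Adj (deleteVertices G S))

    -- The invariant of the search: `mid` is exactly S, `left` consists of vertices joined to x by a
    -- path, and `right` holds the vertices not yet reached.
    record Reached (σ : Colouring n) : Set where
      field
        source : σ (proj₁ x) ≡ left
        mid⇒∈  : ∀ {v} → σ v ≡ mid → v ∈ S
        ∈⇒mid  : ∀ {v} → v ∈ S → σ v ≡ mid
        reach  : ∀ v → σ v ≡ left → ∃ λ v∉S → x ⇝ (v , v∉S)

    open Reached

    mid-bound : ∀ {σ} → Reached σ → # mid σ < k
    mid-bound r = ≤-<-trans (sum-mono λ v → 𝟙≤ (_ ≟ mid) (1≤𝟙 (v ∈? S) ∘ mid⇒∈ r)) (subst (_< k) (∣∣-sum S) ∣S∣<k)

    extend : ∀ {σ a b} → Reached σ → Crosses G σ a b → Reached (recolour b left σ)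
    extend {σ} {a} {b} r (al , br , ab) = record
      { source = go₁ ; mid⇒∈ = go₂ ; ∈⇒mid = go₃ ; reach = go₄ }
      where
      b∉S : b ∈ ∁ S
      b∉S = x∉p⇒x∈∁p (r≢m br ∘ ∈⇒mid r)
      go₁ : recolour b left σ (proj₁ x) ≡ left
      go₁ with recolour-cases b left σ (proj₁ x)
      ... | inj₁ (_ , e) = e
      ... | inj₂ (_ , e) = trans e (source r)
      go₂ : ∀ {v} → recolour b left σ v ≡ mid → v ∈ S
      go₂ {v} m with recolour-cases b left σ v
      ... | inj₁ (_ , e) with () ← trans (≡-sym m) e
      ... | inj₂ (_ , e) = mid⇒∈ r (trans (≡-sym e) m)
      go₃ : ∀ {v} → v ∈ S → recolour b left σ v ≡ mid
      go₃ {v} v∈S with recolour-cases b left σ v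
      ... | inj₁ (refl , e) = ⊥-elim (x∈∁p⇒x∉p b∉S v∈S)
      ... | inj₂ (_ , e)    = trans e (∈⇒mid r v∈S)
      go₄ : ∀ v → recolour b left σ v ≡ left → ∃ λ v∉S → x ⇝ (v , v∉S)
      go₄ v l with recolour-cases b left σ v
      ... | inj₁ (refl , _) = b∉S , proj₂ (reach r a al) ◅◅ ab ◅ ε
      ... | inj₂ (_ , e)    = reach r v (trans (≡-sym e) l)

    #right-recolour : ∀ {σ} b → σ b ≡ right → # right (recolour b left σ) < # right σ
    #right-recolour {σ} b br = sum-mono-< le b lt
      where
      le : ∀ v → 𝟙 (recolour b left σ v ≟ right) ≤ 𝟙 (σ v ≟ right)
      le v with b ≟ v
      ... | yes _ = z≤n
      ... | no _  = ≤-refl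
      lt : 𝟙 (recolour b left σ b ≟ right) < 𝟙 (σ b ≟ right)
      lt with b ≟ b
      ... | yes _ = 1≤𝟙 (σ b ≟ right) br
      ... | no ¬e = ⊥-elim (¬e refl)

    grow : ∀ σ → Acc _<_ (# right σ) → Reached σ → x ⇝ y
    grow σ (acc rec) r = go (σ (proj₁ y)) refl
      where
      go : ∀ p → σ (proj₁ y) ≡ p → x ⇝ y
      go left  e with reach r (proj₁ y) e
      -- A vertex of `deleteVertices` carries a membership proof, and the path may end at y with a
      -- different one; irrelevance identifies the two.
      ... | y∉S , path = subst (λ p → x ⇝ (proj₁ y , p)) ([]=-irrelevant y∉S (proj₂ y)) path
      go mid   e = ⊥-elim (x∈∁p⇒x∉p (proj₂ y) (mid⇒∈ r e))
      go right e with any? (λ a → any? λ b → crosses? G σ a b)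
      ... | no none = ⊥-elim (insep σ (separation (_ , source r) (_ , e) (mid-bound r) λ a b c → none (a , b , c)))
      ... | yes (a , b , c) = grow (recolour b left σ) (rec (#right-recolour b (proj₁ (proj₂ c)))) (extend r c)

    start : Colouring n
    start v = if does (proj₁ x ≟ v) then left else if does (v ∈? S) then mid else right

    start-reached : Reached start
    start-reached = record { source = go₁ ; mid⇒∈ = go₂ _ ; ∈⇒mid = go₃ _ ; reach = go₄ }
      where
      go₁ : start (proj₁ x) ≡ left
      go₁ with proj₁ x ≟ proj₁ x
      ... | yes _ = refl
      ... | no ¬e = ⊥-elim (¬e refl)
      go₂ : ∀ v → start v ≡ mid → v ∈ S
      go₂ v e with proj₁ x ≟ v | v ∈? S
      ... | no _ | yes v∈S = v∈S
      go₃ : ∀ v → v ∈ S → start v ≡ mid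
      go₃ v v∈S with proj₁ x ≟ v | v ∈? S
      ... | no _     | yes _  = refl
      ... | no _     | no v∉S = ⊥-elim (v∉S v∈S)
      ... | yes refl | _      = ⊥-elim (x∈∁p⇒x∉p (proj₂ x) v∈S)
      go₄ : ∀ v → start v ≡ left → ∃ λ v∉S → x ⇝ (v , v∉S)
      go₄ v e with proj₁ x ≟ v | v ∈? S
      ... | yes refl | _ = proj₂ x , ε
      ... | no _ | yes _ with () ← e
      ... | no _ | no _ with () ← e

  conn : ∀ S → ∣ S ∣ < k → Connected (deleteVertices G S)
  conn S ∣S∣<k x y = grow S ∣S∣<k x y _ (<-wellFounded _) (start-reached S ∣S∣<k x y)

-- Counting in the corners of two separations.

module _ {n : ℕ} (σ τ : Colouring n) where

  ∑₂ : (Side → Side → ℕ) → ℕ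
  ∑₂ f = sum (λ v → f (σ v) (τ v))

  -- Both sides depend on a vertex only through its pair of colours, so it suffices to compare the
  -- nine pairs, which evaluation of the implicit `True` argument does.
  ∑₂-balance : ∀ a b c d → {True (all? {3} λ p → all? {3} λ q → a p q + b p q ℕ.≟ c p q + d p q)} →
               ∑₂ a + ∑₂ b ≡ ∑₂ c + ∑₂ d
  ∑₂-balance a b c d {eq} = begin
    ∑₂ a + ∑₂ b                                        ≡⟨ ∑-distrib-+ (λ v → a (σ v) (τ v)) (λ v → b (σ v) (τ v)) ⟨
    sum (λ v → a (σ v) (τ v) + b (σ v) (τ v))          ≡⟨ sum-cong-≗ (λ v → toWitness eq (σ v) (τ v)) ⟩
    sum (λ v → c (σ v) (τ v) + d (σ v) (τ v))          ≡⟨ ∑-distrib-+ (λ v → c (σ v) (τ v)) (λ v → d (σ v) (τ v)) ⟩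
    ∑₂ c + ∑₂ d ∎
    where open ≡-Reasoning

  cell : Side → Side → Side → Side → ℕ
  cell p q p′ q′ = 𝟙 (p′ ≟ p) * 𝟙 (q′ ≟ q)

  #₂ : Side → Side → ℕ
  #₂ p q = ∑₂ (cell p q)

  1≤cell : ∀ {p q} v → σ v ≡ p → τ v ≡ q → 1 ≤ cell p q (σ v) (τ v)
  1≤cell {p} {q} v e f = *-mono-≤ (1≤𝟙 (σ v ≟ p) e) (1≤𝟙 (τ v ≟ q) f)

  cell≤ˡ : ∀ {p q} v → cell p q (σ v) (τ v) ≤ 𝟙 (σ v ≟ p)
  cell≤ˡ {p} {q} v = begin
    𝟙 (σ v ≟ p) * 𝟙 (τ v ≟ q) ≤⟨ *-monoʳ-≤ (𝟙 (σ v ≟ p)) (𝟙≤ (τ v ≟ q) (λ _ → ≤-refl)) ⟩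
    𝟙 (σ v ≟ p) * 1           ≡⟨ *-identityʳ _ ⟩
    𝟙 (σ v ≟ p) ∎
    where open ≤-Reasoning

  -- Modularity: the separators of two opposite corners together contain each vertex exactly as
  -- often as S and T do.
  #mid-∨ : # mid (λ v → σ v ∨ τ v) + # mid (λ v → flip (σ v) ∨ flip (τ v)) ≡ # mid σ + # mid τ
  #mid-∨ = ∑₂-balance (λ p q → 𝟙 (p ∨ q ≟ mid)) (λ p q → 𝟙 (flip p ∨ flip q ≟ mid)) (λ p q → 𝟙 (p ≟ mid)) (λ p q → 𝟙 (q ≟ mid))

  #mid-∨-flip : # mid (λ v → σ v ∨ flip (τ v)) + # mid (λ v → flip (σ v) ∨ τ v) ≡ # mid σ + # mid τ
  #mid-∨-flip = ∑₂-balance (λ p q → 𝟙 (p ∨ flip q ≟ mid)) (λ p q → 𝟙 (flip p ∨ q ≟ mid)) (λ p q → 𝟙 (p ≟ mid)) (λ p q → 𝟙 (q ≟ mid))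

  -- The separator of A∩C arises from S by trading S∩D for A∩T.
  #mid-∨-cell : # mid (λ v → σ v ∨ τ v) + #₂ mid right ≡ # mid σ + #₂ left mid
  #mid-∨-cell = ∑₂-balance (λ p q → 𝟙 (p ∨ q ≟ mid)) (cell mid right) (λ p q → 𝟙 (p ≟ mid)) (cell left mid)

  -- The separator of A∩D arises from T by trading B∩T for S∩D.
  #mid-∨-flip-cell : # mid (λ v → σ v ∨ flip (τ v)) + #₂ right mid ≡ # mid τ + #₂ mid right
  #mid-∨-flip-cell = ∑₂-balance (λ p q → 𝟙 (p ∨ flip q ≟ mid)) (cell right mid) (λ p q → 𝟙 (q ≟ mid)) (cell mid right)

-- Critical edges and uncrossing.

-- `σ` becomes a separation of H once xy is deleted. The end x lies on the left, so the notion is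
-- oriented; `critical-flip` reverses it.
record Critical {n} (H : Graph (Fin n)) (k : ℕ) (x y : Fin n) (σ : Colouring n) : Set where
  constructor critical
  field
    x-left  : σ x ≡ left
    y-right : σ y ≡ right
    small   : # mid σ < k
    only    : ∀ u v → Crosses H σ u v → u ≡ x × v ≡ y

critical-flip : ∀ {n k} {H : Graph (Fin n)} {x y σ} → Critical H k x y σ → Critical H k y x (flip ∘ σ)
critical-flip {H = H} {σ = σ} (critical l r s o) = critical (cong flip r) (cong flip l)
  (subst (_< _) (≡-sym (#mid-flip σ)) s)
  λ u v (ul , vr , uv) → let (a , b) = o v u (flip-right _ vr , flip-left _ ul , sym H uv) in b , a

module _ {n} {H : Graph (Fin n)} {k} (insep : Inseparable H k) where

  -- Moving x into the separator destroys all crossing edges.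
  left-singleton : ∀ {ρ x r} → ρ x ≡ left → ρ r ≡ right → suc (# mid ρ) < k →
                   (∀ u v → Crosses H ρ u v → u ≡ x) → ∀ u → ρ u ≡ left → u ≡ x
  left-singleton {ρ} {x} {r} xl rr s o u ul with u ≟ x
  ... | yes e = e
  ... | no u≢x = ⊥-elim (insep ρ′ (separation (u , trans (outside u u≢x) ul) (r , trans (outside r r≢x) rr)
                   (≤-<-trans (#mid-recolour x ρ) s) none))
    where
    ρ′ = recolour x mid ρ
    r≢x : r ≢ x
    r≢x refl = l≢r xl rr
    outside : ∀ v → v ≢ x → ρ′ v ≡ ρ v
    outside v v≢x with recolour-cases x mid ρ v
    ... | inj₁ (e , _) = ⊥-elim (v≢x (≡-sym e))
    ... | inj₂ (_ , e) = e
    none : ∀ a b → ¬ Crosses H ρ′ a b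
    none a b (al , br , ab) with recolour-cases x mid ρ a | recolour-cases x mid ρ b
    ... | inj₁ (_ , e) | _ with () ← trans (≡-sym e) al
    none a b (al , br , ab) | inj₂ _ | inj₁ (_ , e) with () ← trans (≡-sym e) br
    none a b (al , br , ab) | inj₂ (x≢a , e) | inj₂ (_ , f) =
      x≢a (≡-sym (o a b (trans (≡-sym e) al , trans (≡-sym f) br , ab)))

  -- Mader's uncrossing; below, A|S|B and C|T|D are the separations given by σ and τ.
  module _ {x y z σ τ} (σ-crit : Critical H k x y σ) (τ-crit : Critical H k x z τ) (y≢z : y ≢ z)
           (xy : Adj H x y) (xz : Adj H x z) (k<deg : k < degree H x)
           (A≤B : # left σ ≤ # right σ) (A≤D : # left σ ≤ # right τ) where

    private
      module σ = Critical σ-crit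
      module τ = Critical τ-crit

      AC AD BC BD : Colouring n
      AC v = σ v ∨ τ v
      AD v = σ v ∨ flip (τ v)
      BC v = flip (σ v) ∨ τ v
      BD v = flip (σ v) ∨ flip (τ v)

      y∉D : τ y ≢ right
      y∉D r = y≢z (proj₂ (τ.only x y (τ.x-left , r , xy)))

      z∉B : σ z ≢ right
      z∉B r = y≢z (≡-sym (proj₂ (σ.only x z (σ.x-left , r , xz))))

      σ-only : ∀ u v → σ u ≡ left → σ v ≡ right → Adj H u v → u ≡ x × v ≡ y
      σ-only u v l r e = σ.only u v (l , r , e)

      τ-only : ∀ u v → τ u ≡ left → τ v ≡ right → Adj H u v → u ≡ x × v ≡ z
      τ-only u v l r e = τ.only u v (l , r , e)

      AC-crosses : ∀ u v → Crosses H AC u v → u ≡ x × (v ≡ y ⊎ v ≡ z)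
      AC-crosses u v (ul , vr , uv) with ∨-left (σ u) (τ u) ul | ∨-right (σ v) (τ v) vr
      ... | ul₁ , ul₂ | inj₁ vr₁ = let (a , b) = σ-only u v ul₁ vr₁ uv in a , inj₁ b
      ... | ul₁ , ul₂ | inj₂ vr₂ = let (a , b) = τ-only u v ul₂ vr₂ uv in a , inj₂ b

      xAC : AC x ≡ left
      xAC = cong₂ _∨_ σ.x-left τ.x-left

      -- With at most k - 2 separator vertices, `left-singleton` would make x the only vertex of
      -- A∩C. Every neighbour of x would then be y, z or a separator vertex, at most k in all,
      -- against `k<deg`.
      k≤1+AC : k ≤ suc (# mid AC)
      k≤1+AC with k ≤? suc (# mid AC)
      ... | yes le = le
      ... | no nle = ⊥-elim (<⇒≱ k<deg (begin
          degree H x                                         ≡⟨ degree-sum H x ⟩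
          sum (λ v → 𝟙 (adj? H x v))                         ≤⟨ sum-mono nbr ⟩
          sum (λ v → 𝟙 (y ≟ v) + (𝟙 (z ≟ v) + 𝟙 (AC v ≟ mid)))
            ≡⟨ trans (∑-distrib-+ (λ v → 𝟙 (y ≟ v)) (λ v → 𝟙 (z ≟ v) + 𝟙 (AC v ≟ mid)))
                 (cong (sum (λ v → 𝟙 (y ≟ v)) +_) (∑-distrib-+ (λ v → 𝟙 (z ≟ v)) (λ v → 𝟙 (AC v ≟ mid)))) ⟩
          sum (λ v → 𝟙 (y ≟ v)) + (sum (λ v → 𝟙 (z ≟ v)) + # mid AC)
            ≡⟨ cong₂ (λ a b → a + (b + # mid AC)) (sum-≟ y) (sum-≟ z) ⟩
          suc (suc (# mid AC))                               ≤⟨ lt ⟩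
          k ∎))
        where
        open ≤-Reasoning
        lt : suc (# mid AC) < k
        lt = ≰⇒> nle
        singleton : ∀ u → AC u ≡ left → u ≡ x
        singleton = left-singleton xAC (right-∨ (σ y) (τ y) σ.y-right) lt λ u v c → proj₁ (AC-crosses u v c)
        nbr : ∀ v → 𝟙 (adj? H x v) ≤ 𝟙 (y ≟ v) + (𝟙 (z ≟ v) + 𝟙 (AC v ≟ mid))
        nbr v = 𝟙≤ (adj? H x v) λ xv → go (AC v) refl xv
          where
          go : ∀ p → AC v ≡ p → Adj H x v → 1 ≤ 𝟙 (y ≟ v) + (𝟙 (z ≟ v) + 𝟙 (AC v ≟ mid))
          go left  e xv = ⊥-elim (irrefl H (≡-sym (singleton v e)) xv)
          go mid   e xv = ≤-trans (1≤𝟙 (AC v ≟ mid) e) (≤-trans (m≤n+m _ (𝟙 (z ≟ v))) (m≤n+m _ (𝟙 (y ≟ v))))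
          go right e xv with proj₂ (AC-crosses x v (xAC , e , xv))
          ... | inj₁ v≡y = ≤-trans (1≤𝟙 (y ≟ v) (≡-sym v≡y)) (m≤m+n _ _)
          ... | inj₂ v≡z = ≤-trans (1≤𝟙 (z ≟ v) (≡-sym v≡z)) (≤-trans (m≤m+n _ _) (m≤n+m _ (𝟙 (y ≟ v))))

      BD-small : # mid BD < k
      BD-small = +-cancelˡ-< (# mid AC) _ _ (begin-strict
        # mid AC + # mid BD   ≡⟨ #mid-∨ σ τ ⟩
        # mid σ + # mid τ     <⟨ +-mono-≤-< (s≤s⁻¹ (≤-trans σ.small k≤1+AC)) τ.small ⟩
        # mid AC + k ∎)
        where
        open ≤-Reasoning
        

      -- An edge leaving B∩D would start at y, which is not in D, or at z, which is not in B. A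
      -- vertex of B∩D would thus be separated from x by fewer than k vertices.
      BD-empty : ∀ v → σ v ≡ right → τ v ≢ right
      BD-empty v r₁ r₂ = insep BD (separation (v , cong₂ (λ p q → flip p ∨ flip q) r₁ r₂)
        (x , right-∨ _ _ (cong flip σ.x-left)) BD-small none)
        where
        none : ∀ a b → ¬ Crosses H BD a b
        none a b (al , br , ab) with ∨-left (flip (σ a)) (flip (τ a)) al | ∨-right (flip (σ b)) (flip (τ b)) br
        ... | a₁ , a₂ | inj₁ b₁ =
          y∉D (subst (λ w → τ w ≡ right) (proj₂ (σ-only b a (flip-right _ b₁) (flip-left _ a₁) (sym H ab))) (flip-left _ a₂))
        ... | a₁ , a₂ | inj₂ b₂ =
          z∉B (subst (λ w → σ w ≡ right) (proj₂ (τ-only b a (flip-right _ b₂) (flip-left _ a₂) (sym H ab))) (flip-left _ a₁))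

      SD≤AT : #₂ σ τ mid right ≤ #₂ σ τ left mid
      SD≤AT = +-cancelˡ-≤ (# mid AC) _ _ (begin
        # mid AC + #₂ σ τ mid right  ≡⟨ #mid-∨-cell σ τ ⟩
        # mid σ + #₂ σ τ left mid    ≤⟨ +-monoˡ-≤ _ (s≤s⁻¹ (≤-trans σ.small k≤1+AC)) ⟩
        # mid AC + #₂ σ τ left mid ∎)
        where open ≤-Reasoning

      -- Strict because x is in A but not in T.
      AT<A : #₂ σ τ left mid < # left σ
      AT<A = sum-mono-< (cell≤ˡ σ τ) x lt
        where
        lt : cell σ τ left mid (σ x) (τ x) < 𝟙 (σ x ≟ left)
        lt rewrite σ.x-left | τ.x-left = s≤s z≤n

      SD<A : #₂ σ τ mid right < # left σ
      SD<A = ≤-<-trans SD≤AT AT<A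

      -- Otherwise D lies inside S, since B∩D is empty too, and |D| ≤ |S∩D| < |A| contradicts `A≤D`.
      A∩D-inhabited : ¬ (∀ v → σ v ≡ left → τ v ≢ right)
      A∩D-inhabited empty = <⇒≱ SD<A (≤-trans A≤D (sum-mono λ v → 𝟙≤ (τ v ≟ right) λ r → 1≤cell σ τ v (in-mid v r) r))
        where
        in-mid : ∀ v → τ v ≡ right → σ v ≡ mid
        in-mid v r = go (σ v) refl
          where
          go : ∀ p → σ v ≡ p → σ v ≡ mid
          go left  e = ⊥-elim (empty v e r)
          go mid   e = e
          go right e = ⊥-elim (BD-empty v e r)

      AD-crosses : ∀ a b → Crosses H AD a b → a ≡ z × b ≡ x
      AD-crosses a b (al , br , ab) with ∨-left (σ a) (flip (τ a)) al | ∨-right (σ b) (flip (τ b)) br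
      ... | a₁ , a₂ | inj₁ b₁ = ⊥-elim (l≢r (subst (λ w → τ w ≡ left) (≡-sym (proj₁ (σ-only a b a₁ b₁ ab))) τ.x-left) (flip-left _ a₂))
      ... | a₁ , a₂ | inj₂ b₂ = let (c , d) = τ-only b a (flip-right _ b₂) (flip-left _ a₂) (sym H ab) in d , c

      xAD : AD x ≡ right
      xAD = ∨-right′ _ _ (cong flip τ.x-left)

      -- With so large a separator for A∩D, trading gives |B∩T| ≤ |S∩D| < |A|, and modularity leaves
      -- at most k - 2 vertices for the separator of B∩C. That forces B∩C to be empty. As B∩D is
      -- empty too, B lies inside T, and |B| ≤ |B∩T| contradicts `A≤B`.
      k≤AD⇒⊥ : ¬ k ≤ # mid AD
      k≤AD⇒⊥ k≤AD = <⇒≱ (≤-<-trans BT≤SD SD<A) (≤-trans A≤B B≤BT)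
        where
        BT≤SD : #₂ σ τ right mid ≤ #₂ σ τ mid right
        BT≤SD = +-cancelˡ-≤ (# mid AD) _ _ (begin
          # mid AD + #₂ σ τ right mid ≡⟨ #mid-∨-flip-cell σ τ ⟩
          # mid τ + #₂ σ τ mid right  ≤⟨ +-monoˡ-≤ _ (≤-trans (<⇒≤ τ.small) k≤AD) ⟩
          # mid AD + #₂ σ τ mid right ∎)
          where open ≤-Reasoning
        BC-small : suc (# mid BC) < k
        BC-small = +-cancelˡ-< (# mid AD) _ _ (begin-strict
          # mid AD + suc (# mid BC)  ≡⟨ +-suc _ _ ⟩
          suc (# mid AD + # mid BC)  ≡⟨ cong suc (#mid-∨-flip σ τ) ⟩
          suc (# mid σ) + # mid τ    <⟨ +-mono-≤-< (≤-trans σ.small k≤AD) τ.small ⟩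
          # mid AD + k ∎)
          where open ≤-Reasoning
        -- `flip ∘ BC` puts B∩C on the right, and all edges into it start at x. By `left-singleton`
        -- the opposite side would be x alone, but z lies there as well.
        BC-empty : ∀ v → σ v ≡ right → τ v ≢ left
        BC-empty v r l = irrefl H (≡-sym (left-singleton {ρ = flip ∘ BC} xl (cong flip (cong₂ (λ p q → flip p ∨ q) r l))
            (subst (λ m → suc m < k) (≡-sym (#mid-flip BC)) BC-small) from-x z zl)) xz
          where
          xl : flip (BC x) ≡ left
          xl rewrite σ.x-left = refl
          zl : flip (BC z) ≡ left
          zl = cong flip (∨-right′ _ _ τ.y-right)
          from-x : ∀ a b → Crosses H (flip ∘ BC) a b → a ≡ x
          from-x a b (al , br , ab) with ∨-right (flip (σ a)) (τ a) (flip-left _ al) | ∨-left (flip (σ b)) (τ b) (flip-right _ br)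
          ... | inj₁ a₁ | b₁ , b₂ = proj₁ (σ-only a b (flip-right _ a₁) (flip-left _ b₁) ab)
          ... | inj₂ a₂ | b₁ , b₂ =
            ⊥-elim (l≢r σ.x-left (subst (λ w → σ w ≡ right) (proj₁ (τ-only b a b₂ a₂ (sym H ab))) (flip-left _ b₁)))
        B≤BT : # right σ ≤ #₂ σ τ right mid
        B≤BT = sum-mono λ v → 𝟙≤ (σ v ≟ right) λ r → 1≤cell σ τ v r (in-mid v r)
          where
          in-mid : ∀ v → σ v ≡ right → τ v ≡ mid
          in-mid v r = go (τ v) refl
            where
            go : ∀ p → τ v ≡ p → τ v ≡ mid
            go left  e = ⊥-elim (BC-empty v r e)
            go mid   e = e
            go right e = ⊥-elim (BD-empty v r e)

    -- The corner A∩D serves: zx is the only edge that can leave it, and it misses x, so it is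
    -- smaller than A. If z were outside, no edge at all would leave this nonempty corner, giving a
    -- separation of H.
    uncross : ∃ λ ρ → Critical H k z x ρ × # left ρ < # left σ
    uncross with # mid AD <? k
    ... | no nlt = ⊥-elim (k≤AD⇒⊥ (≮⇒≥ nlt))
    ... | yes AD-small with AD z ≟ left
    ...   | yes zl = AD , critical zl xAD AD-small AD-crosses , sum-mono-< le x lt
      where
      le : ∀ v → 𝟙 (AD v ≟ left) ≤ 𝟙 (σ v ≟ left)
      le v = 𝟙≤ (AD v ≟ left) λ e → 1≤𝟙 (σ v ≟ left) (proj₁ (∨-left (σ v) _ e))
      lt : 𝟙 (AD x ≟ left) < 𝟙 (σ x ≟ left)
      lt rewrite xAD | σ.x-left = ≤-refl
    ...   | no ¬zl = ⊥-elim (A∩D-inhabited λ v l r → insep AD (separation (v , cong₂ (λ p q → p ∨ flip q) l r) (x , xAD) AD-small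
                       λ a b c → ¬zl (subst (λ w → AD w ≡ left) (proj₁ (AD-crosses a b c)) (proj₁ c))))

  module _ {W : Fin n → Set} (W? : ∀ v → Dec (W v))
           (W-crit : ∀ x y → W x → W y → Adj H x y → ∃ (Critical H k x y))
           (W-deg : ∀ x → W x → k < degree H x) where

    -- Descent on the size of the left side A of a critical edge xy. If B is smaller, reverse the
    -- edge. Otherwise a second neighbour z of x in W gives either a side D of xz smaller than A or,
    -- by uncrossing, a smaller side for zx. The descent ends where there is no second neighbour.
    leaf-from : ∀ x y σ → Acc _<_ (# left σ) → W x → W y → Adj H x y → Critical H k x y σ →
                ∃ λ w → W w × ∃ λ y → ∀ v → W v → Adj H w v → v ≡ y
    leaf-from x y σ (acc rec) wx wy xy c with # left σ ≤? # right σ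
    ... | no A≰B = leaf-from y x (flip ∘ σ) (rec (subst (_< # left σ) (≡-sym (#left-flip σ)) (≰⇒> A≰B))) wy wx (sym H xy) (critical-flip c)
    ... | yes A≤B with any? (λ z → W? z ×-dec adj? H x z ×-dec ¬? (z ≟ y))
    ...   | no none = x , wx , y , λ v wv xv → unique v wv xv
      where
      unique : ∀ v → W v → Adj H x v → v ≡ y
      unique v wv xv with v ≟ y
      ... | yes e = e
      ... | no ¬e = ⊥-elim (none (v , wv , xv , ¬e))
    ...   | yes (z , wz , xz , z≢y) with W-crit x z wx wz xz
    ...     | τ , d with # left σ ≤? # right τ
    ...       | no A≰D = leaf-from z x (flip ∘ τ) (rec (subst (_< # left σ) (≡-sym (#left-flip τ)) (≰⇒> A≰D))) wz wx (sym H xz) (critical-flip d)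
    ...       | yes A≤D with uncross c d (z≢y ∘ ≡-sym) xy xz (W-deg x wx) A≤B A≤D
    ...         | ρ , e , lt = leaf-from z x ρ (rec lt) wz wx (sym H xz) e

    -- Mader: critical edges between vertices of degree > k form a forest.
    leaf : ∃ W → ∃ λ w → W w × ∃ λ y → ∀ v → W v → Adj H w v → v ≡ y
    leaf (x , wx) with any? (λ y → W? y ×-dec adj? H x y)
    -- x is isolated in W, so any vertex may stand for y.
    ... | no none          = x , wx , x , λ v wv xv → ⊥-elim (none (v , wv , xv))
    ... | yes (y , wy , xy) = let (σ , c) = W-crit x y wx wy xy in leaf-from x y σ (<-wellFounded _) wx wy xy c

-- Auxiliary lemmas on sums and lists.

≤1 : ∀ {P : Set} (d : Dec P) → 𝟙 d ≤ 1
≤1 d = 𝟙≤ d λ _ → ≤-refl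

sum-1 : ∀ n → sum {n} (λ _ → 1) ≡ n
sum-1 zero    = refl
sum-1 (suc n) = cong suc (sum-1 n)

sum-point : ∀ {n} (f : Fin n → ℕ) x → sum (λ v → 𝟙 (x ≟ v) * f v) ≡ f x
sum-point {suc n} f zero    = trans (cong₂ _+_ (*-identityˡ (f zero)) (sum-0 {n} λ v → refl)) (+-identityʳ _)
sum-point {suc n} f (suc x) = trans (sum-cong-≗ lem) (sum-point (f ∘ suc) x)
  where
  lem : ∀ v → 𝟙 (suc x ≟ suc v) * f (suc v) ≡ 𝟙 (x ≟ v) * f (suc v)
  lem v with x ≟ v
  ... | yes _ = refl
  ... | no _  = refl

sum-+-≤ : ∀ n {f g : Fin n → ℕ} {a b} → sum f ≤ a → sum g ≤ b → sum (λ v → f v + g v) ≤ a + b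
sum-+-≤ n {f} {g} f≤ g≤ = ≤-trans (≤-reflexive (∑-distrib-+ f g)) (+-mono-≤ f≤ g≤)

-- Turns a decision at each index into a global one: `A` will be the existence of a larger matching,
-- `B` the criticality of the edges at hand.
first-or-all : ∀ {n} {A : Set} {B : Fin n → Set} → (∀ i → A ⊎ B i) → A ⊎ (∀ i → B i)
first-or-all {zero}  f = inj₂ λ ()
first-or-all {suc n} f with f zero | first-or-all (f ∘ suc)
... | inj₁ a | _      = inj₁ a
... | inj₂ _ | inj₁ a = inj₁ a
... | inj₂ b | inj₂ g = inj₂ λ { zero → b ; (suc i) → g i }

-- Symmetry of `R` keeps the relations intact under reordering; this brings a chosen matching edge
-- to the front.
extract : ∀ {A : Set} {P : A → Set} {R : A → A → Set} → Symmetric R → ∀ {xs} → Any P xs → AllPairs R xs →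
          ∃₂ λ x ys → P x × AllPairs R (x ∷ ys) × xs ↭ x ∷ ys
extract R-sym (here px)  rs       = _ , _ , px , rs , ↭-refl
extract R-sym (there p) (r ∷ rs) with extract R-sym p rs
... | x , ys , px , (q ∷ qs) , perm with All-resp-↭ perm r
...   | r₁ ∷ r₂ = x , _ ∷ ys , px , (R-sym r₁ ∷ q) ∷ r₂ ∷ qs , ↭-trans (prep _ perm) (swap _ _ ↭-refl)

δ≤degree : ∀ {n} (G : Graph (Fin n)) u → δ G ≤ degree G u
δ≤degree {n} G u = All.lookup (min≤xs n (map (degree G) (allFin n))) (∈-map⁺ (degree G) (∈-allFin u))

-- Vertices covered by a matching.

module _ {n} {G : Graph (Fin n)} where

  Covered : List (Edge G) → Fin n → Set
  Covered M v = Any (v ∈ᵉ_) M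

  covered? : ∀ M v → Dec (Covered M v)
  covered? M v = Any.any? (λ e → v ≟ src e ⊎-dec v ≟ tgt e) M

  joins? : ∀ u v (e : Edge G) → Dec (Joins u v e)
  joins? u v e = (src e ≟ u ×-dec tgt e ≟ v) ⊎-dec (src e ≟ v ×-dec tgt e ≟ u)

  joins-swap : ∀ {u v} (e : Edge G) → Joins u v e → Joins v u e
  joins-swap e = Sum.swap

  joins⇒∈ : ∀ {u v} (e : Edge G) → Joins u v e → u ∈ᵉ e
  joins⇒∈ e (inj₁ (refl , _)) = inj₁ refl
  joins⇒∈ e (inj₂ (_ , refl)) = inj₂ refl

  ∑ᴱ : (Fin n → ℕ) → List (Edge G) → ℕ
  ∑ᴱ f []      = 0
  ∑ᴱ f (e ∷ M) = f (src e) + f (tgt e) + ∑ᴱ f M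

  -- Every vertex where f is nonzero is an end of an edge of M, so summing over edge ends counts it
  -- at least once.
  sum≤∑ᴱ : ∀ f M → (∀ v → ¬ Covered M v → f v ≡ 0) → sum f ≤ ∑ᴱ f M
  sum≤∑ᴱ f M f≡0 = ≤-trans (sum-mono bound) (≤-reflexive (total M))
    where
    -- The share of v in `∑ᴱ f M`, so that the order of summation can be exchanged.
    at : List (Edge G) → Fin n → ℕ
    at []      v = 0
    at (e ∷ M) v = 𝟙 (src e ≟ v) * f v + 𝟙 (tgt e ≟ v) * f v + at M v
    total : ∀ M → sum (at M) ≡ ∑ᴱ f M
    total []      = sum-0 {n} λ _ → refl
    total (e ∷ M) = trans (∑-distrib-+ (λ v → 𝟙 (src e ≟ v) * f v + 𝟙 (tgt e ≟ v) * f v) (at M))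
      (cong₂ _+_ (trans (∑-distrib-+ (λ v → 𝟙 (src e ≟ v) * f v) (λ v → 𝟙 (tgt e ≟ v) * f v))
                        (cong₂ _+_ (sum-point f (src e)) (sum-point f (tgt e)))) (total M))
    point : ∀ {x v} → x ≡ v → f v ≤ 𝟙 (x ≟ v) * f v
    point {x} {v} e = ≤-trans (≤-reflexive (≡-sym (*-identityˡ (f v)))) (*-monoˡ-≤ (f v) (1≤𝟙 (x ≟ v) e))
    f≤at : ∀ M v → Covered M v → f v ≤ at M v
    f≤at (e ∷ M) v (here (inj₁ p)) = ≤-trans (point (≡-sym p)) (≤-trans (m≤m+n _ _) (m≤m+n (𝟙 (src e ≟ v) * f v + 𝟙 (tgt e ≟ v) * f v) (at M v)))
    f≤at (e ∷ M) v (here (inj₂ p)) = ≤-trans (point (≡-sym p)) (≤-trans (m≤n+m _ (𝟙 (src e ≟ v) * f v)) (m≤m+n _ (at M v)))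
    f≤at (e ∷ M) v (there c)       = ≤-trans (f≤at M v c) (m≤n+m _ _)
    bound : ∀ v → f v ≤ at M v
    bound v with covered? M v
    ... | yes c = f≤at M v c
    ... | no ¬c = ≤-trans (≤-reflexive (f≡0 v ¬c)) z≤n

  sum-covered : ∀ M → sum (λ v → 𝟙 (covered? M v)) ≤ 2 * length M
  sum-covered M = ≤-trans (sum≤∑ᴱ _ M λ v → 𝟙-no (covered? M v)) (bound M)
    where
    bound : ∀ N → ∑ᴱ (λ v → 𝟙 (covered? M v)) N ≤ 2 * length N
    bound []      = z≤n
    bound (e ∷ N) = ≤-trans (+-mono-≤ (+-mono-≤ (≤1 (covered? M (src e))) (≤1 (covered? M (tgt e)))) (bound N))
      (≤-reflexive (≡-sym (*-suc 2 (length N))))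

  -- Pigeonhole: if each edge received at most 2, the total would not exceed 2|M|.
  heavy-edge : ∀ f M → 2 * length M < ∑ᴱ f M → Any (λ e → 3 ≤ f (src e) + f (tgt e)) M
  heavy-edge f (e ∷ M) lt with 3 ≤? f (src e) + f (tgt e)
  ... | yes p = here p
  ... | no ¬p = there (heavy-edge f M (+-cancelˡ-< 2 _ _ (≤-trans
      (s≤s (≤-reflexive (≡-sym (*-suc 2 (length M)))))
      (≤-trans lt (+-monoˡ-≤ _ (s≤s⁻¹ (≰⇒> ¬p)))))))

  Disjoint-sym : Symmetric (Disjoint {G = G})
  Disjoint-sym d v (a , b) = d v (b , a)

  joined⇒covered : ∀ {M : List (Edge G)} {u v} → Any (Joins u v) M → Covered M u
  joined⇒covered = Any.map λ {e} → joins⇒∈ e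

  disjoint⇒uncovered : ∀ {e : Edge G} {M v} → All (Disjoint e) M → v ∈ᵉ e → ¬ Covered M v
  disjoint⇒uncovered (d ∷ ds) v∈e (here c)  = d _ (v∈e , c)
  disjoint⇒uncovered {e} (d ∷ ds) v∈e (there c) = disjoint⇒uncovered {e} ds v∈e c

  -- Disjointness leaves x at most one neighbour along M; x itself is the default when there is
  -- none.
  partner : ∀ {M : List (Edge G)} → AllPairs Disjoint M → ∀ x → ∃ λ p → ∀ v → Any (Joins x v) M → p ≡ v
  partner []                 x = x , λ _ ()
  partner (_∷_ {x = e} d ds) x with x ≟ src e | x ≟ tgt e
  ... | yes refl | _ = tgt e , λ
    { v (here (inj₁ (_ , q))) → q
    ; v (here (inj₂ (p , q))) → trans q p
    ; v (there j) → ⊥-elim (disjoint⇒uncovered {e} d (inj₁ refl) (joined⇒covered j)) }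
  ... | no _ | yes refl = src e , λ
    { v (here (inj₁ (p , q))) → trans p q
    ; v (here (inj₂ (p , q))) → p
    ; v (there j) → ⊥-elim (disjoint⇒uncovered {e} d (inj₂ refl) (joined⇒covered j)) }
  ... | no ¬s | no ¬t with partner ds x
  ...   | p , u = p , λ
    { v (here (inj₁ (p , q))) → ⊥-elim (¬s (≡-sym p))
    ; v (here (inj₂ (p , q))) → ⊥-elim (¬t (≡-sym q))
    ; v (there j) → u v j }

-- Adding one edge to a removable matching.

-- H has no separation of its own, so some edge of H crosses `σ`. As all crossing edges join u and
-- x, either `σ` or its flip shows that ux is critical.
separation⇒critical : ∀ {n k} {H H′ : Graph (Fin n)} {u x} → Inseparable H k → ∀ {σ} → Separation H′ k σ →
  (∀ a b → Crosses H σ a b → (a ≡ u × b ≡ x) ⊎ (a ≡ x × b ≡ u)) → ∃ (Critical H k u x)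
separation⇒critical {H = H} insep {σ} (separation l r s _) ends with any? (λ a → any? λ b → crosses? H σ a b)
... | no none = ⊥-elim (insep σ (separation l r s λ a b c → none (a , b , c)))
... | yes (a , b , c@(al , br , _)) with ends a b c
...   | inj₁ (refl , refl) = σ , critical al br s λ u v c′ → one-way u v (ends u v c′) c′
  where
  one-way : ∀ u v → (u ≡ a × v ≡ b) ⊎ (u ≡ b × v ≡ a) → Crosses H σ u v → u ≡ a × v ≡ b
  one-way u v (inj₁ e) _ = e
  one-way u v (inj₂ (refl , refl)) (ul , _) = ⊥-elim (l≢r ul br)
...   | inj₂ (refl , refl) = flip ∘ σ , critical-flip (critical al br s λ u v c′ → one-way u v (ends u v c′) c′)
  where
  one-way : ∀ u v → (u ≡ b × v ≡ a) ⊎ (u ≡ a × v ≡ b) → Crosses H σ u v → u ≡ a × v ≡ b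
  one-way u v (inj₂ e) _ = e
  one-way u v (inj₁ (refl , refl)) (ul , _) = ⊥-elim (l≢r ul br)

module Step {n k} {G : Graph (Fin n)} {M : List (Edge G)} (matching : AllPairs Disjoint M)
            (removable : IsRemovable k G M) (k<degree : ∀ u → k < degree G u) where

  H : Graph (Fin n)
  H = deleteEdges G M

  insep : Inseparable H k
  insep = kConnected⇒inseparable removable

  U : Fin n → Set
  U v = ¬ Covered M v

  U? : ∀ v → Dec (U v)
  U? v = ¬? (covered? M v)

  Extension : Set
  Extension = ∃ λ (M′ : List (Edge G)) → IsMatching (suc (length M)) M′ × IsRemovable k G M′

  -- M contains no edge at an uncovered vertex.
  U-adj : ∀ {u v} → U u → Adj G u v → Adj H u v
  U-adj uu uv = uv , uu ∘ joined⇒covered {G = G}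

  U-degree : ∀ {u} → U u → degree G u ≤ degree H u
  U-degree {u} uu = begin
    degree G u                  ≡⟨ degree-sum G u ⟩
    sum (λ v → 𝟙 (adj? G u v))  ≤⟨ sum-mono (λ v → 𝟙≤ (adj? G u v) (1≤𝟙 (adj? H u v) ∘ U-adj uu)) ⟩
    sum (λ v → 𝟙 (adj? H u v))  ≡⟨ degree-sum H u ⟨
    degree H u ∎
    where open ≤-Reasoning

  AllCritical : Set
  AllCritical = ∀ u x → U u → U x → Adj H u x → ∃ (Critical H k u x)

  -- Each edge ux of H inside U is tried as a new matching edge. If deleting it as well admits a
  -- separation, ux is the only edge of H that can cross it.
  extend-or-critical : Extension ⊎ AllCritical
  extend-or-critical = first-or-all λ u → first-or-all λ x → edge-case u x
    where
    edge-case : ∀ u x → Extension ⊎ (U u → U x → Adj H u x → ∃ (Critical H k u x))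
    edge-case u x with U? u ×-dec U? x ×-dec adj? H u x
    ... | no ¬all = inj₂ λ uu ux a → ⊥-elim (¬all (uu , ux , a))
    ... | yes (uu , ux , a , _) with separable? (deleteEdges G (edge u x a ∷ M)) k
    ...   | no ¬sep = inj₁ (edge u x a ∷ M , ((fresh M uu ux ∷ matching) , refl) ,
                        inseparable⇒kConnected (proj₁ removable) λ σ s → ¬sep (σ , s))
      where
      fresh : ∀ N → ¬ Covered N u → ¬ Covered N x → All (Disjoint (edge u x a)) N
      fresh []      _  _  = []
      fresh (f ∷ N) cu cx = (λ { v (inj₁ refl , q) → cu (here q) ; v (inj₂ refl , q) → cx (here q) })
                            ∷ fresh N (cu ∘ there) (cx ∘ there)
    ...   | yes (σ , s) = inj₂ λ _ _ _ → separation⇒critical insep s ends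
      where
      ends : ∀ p q → Crosses H σ p q → (p ≡ u × q ≡ x) ⊎ (p ≡ x × q ≡ u)
      ends p q (pl , qr , pq , ¬j) with joins? {G = G} p q (edge u x a)
      ... | yes (inj₁ (refl , refl)) = inj₁ (refl , refl)
      ... | yes (inj₂ (refl , refl)) = inj₂ (refl , refl)
      ... | no ¬e = ⊥-elim (Separation.separates s p q (pl , qr , pq , λ { (here e) → ¬e e ; (there j) → ¬j j }))

  module _ (crit : AllCritical) where

    leaf-in : {W : Fin n → Set} → (∀ v → Dec (W v)) → (∀ {v} → W v → U v) → ∃ W →
              ∃ λ w → W w × ∃ λ y → ∀ v → W v → Adj H w v → v ≡ y
    leaf-in W? W⇒U = leaf insep W? (λ x y wx wy → crit x y (W⇒U wx) (W⇒U wy))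
      (λ x wx → <-≤-trans (k<degree x) (U-degree (W⇒U wx)))

    -- A leaf of U has at most one neighbour in U; all others are among the at most 2|M| covered
    -- vertices.
    leaf-degree : ∃ U → ∃ λ u → degree G u ≤ 2 * length M + 1
    leaf-degree ∃U with leaf-in U? id ∃U
    ... | w , uw , y , only-y = w , ≤-trans (≤-reflexive (degree-sum G w))
      (≤-trans (sum-mono nbr) (sum-+-≤ n (sum-covered M) (≤-reflexive (sum-≟ y))))
      where
      nbr : ∀ v → 𝟙 (adj? G w v) ≤ 𝟙 (covered? M v) + 𝟙 (y ≟ v)
      nbr v = 𝟙≤ (adj? G w v) λ wv → go wv (covered? M v) refl
        where
        go : Adj G w v → (d : Dec (Covered M v)) → covered? M v ≡ d → 1 ≤ 𝟙 (covered? M v) + 𝟙 (y ≟ v)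
        go wv (yes c) _ = ≤-trans (1≤𝟙 (covered? M v) c) (m≤m+n _ _)
        go wv (no uv) _ = ≤-trans (1≤𝟙 (y ≟ v) (≡-sym (only-y v uv (U-adj uw wv)))) (m≤n+m _ _)

  uncovered-other : 2 * length M + 1 < n → ∀ w → ∃ λ u → U u × u ≢ w
  uncovered-other lt w with any? (λ u → U? u ×-dec ¬? (u ≟ w))
  ... | yes p = p
  ... | no none = ⊥-elim (<⇒≱ lt (≤-trans (≤-reflexive (≡-sym (sum-1 n))) (≤-trans (sum-mono bound)
      (sum-+-≤ n (sum-covered M) (≤-reflexive (sum-≟ w))))))
    where
    bound : ∀ v → 1 ≤ 𝟙 (covered? M v) + 𝟙 (w ≟ v)
    bound v with covered? M v
    ... | yes c = s≤s z≤n
    ... | no uv with w ≟ v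
    ...   | yes _ = s≤s z≤n
    ...   | no ¬e = ⊥-elim (none (v , uv , ¬e ∘ ≡-sym))

-- Exchanging one edge for two when degrees are at least k + |M| + 1.

module Exchange {n k} {G : Graph (Fin n)} {M : List (Edge G)} (matching : AllPairs Disjoint M)
                (removable : IsRemovable k G M) (deg : ∀ u → k + suc (length M) ≤ degree G u) where

  open Step matching removable (λ u → ≤-trans (≤-trans (m≤m+n (suc k) (length M)) (≤-reflexive (≡-sym (+-suc k (length M))))) (deg u)) public

  private
    j : ℕ
    j = length M

    deg-sum : ∀ u → k + suc j ≤ sum (λ v → 𝟙 (adj? G u v))
    deg-sum u = ≤-trans (deg u) (≤-reflexive (degree-sum G u))

    cov : Fin n → ℕ
    cov v = 𝟙 (covered? M v)

  module _ (crit : AllCritical) where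

    -- Count the neighbours of u and of a leaf w′ of U on the right. Separator vertices count at
    -- most twice, covered vertices elsewhere once, and the extras are `y₁`, `y₂` and one end of ab.
    -- The total 2|S| + 2|M| + 3 falls short of 2(k + |M| + 1) because |S| < k.
    one-sided′ : ∀ {a b σ} → Critical H k a b σ → ∀ {u y} → U u → σ u ≡ left →
                 (∀ v → U v → σ v ≢ mid → Adj H u v → v ≡ y) → ∀ {w} → U w → σ w ≢ right
    one-sided′ {a} {b} {σ} c {u} {y₁} uu ul u-leaf {w} uw wr
      with leaf-in crit {W = λ v → U v × σ v ≡ right} (λ v → U? v ×-dec σ v ≟ right) proj₁ (w , uw , wr)
    ... | w′ , (uw′ , w′r) , y₂ , w′-leaf = 1+n≰n (begin
        suc (m′ + m′ + 2 * j + 1 + 1 + 1)        ≡⟨ arith m′ j ⟩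
        (suc m′ + suc j) + (suc m′ + suc j)       ≤⟨ +-mono-≤ (+-monoˡ-≤ (suc j) small) (+-monoˡ-≤ (suc j) small) ⟩
        (k + suc j) + (k + suc j)                 ≤⟨ +-mono-≤ (deg-sum u) (deg-sum w′) ⟩
        sum (adj u) + sum (adj w′)                ≡⟨ ∑-distrib-+ (adj u) (adj w′) ⟨
        sum (λ v → adj u v + adj w′ v)            ≤⟨ sum-mono bound ⟩
        sum (λ v → mid# v + mid# v + cov v + 𝟙 (y₁ ≟ v) + 𝟙 (y₂ ≟ v) + 𝟙 (z ≟ v))
          ≤⟨ sum-+-≤ n (sum-+-≤ n (sum-+-≤ n (sum-+-≤ n (sum-+-≤ n ≤-refl ≤-refl) (sum-covered M))
               (≤-reflexive (sum-≟ y₁))) (≤-reflexive (sum-≟ y₂))) (≤-reflexive (sum-≟ z)) ⟩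
        m′ + m′ + 2 * j + 1 + 1 + 1 ∎)
      where
      open ≤-Reasoning
      open Critical c
      arith : ∀ s j → suc (s + s + 2 * j + 1 + 1 + 1) ≡ (suc s + suc j) + (suc s + suc j)
      arith = solve-∀
      m′ = # mid σ
      adj : Fin n → Fin n → ℕ
      adj x v = 𝟙 (adj? G x v)
      mid# : Fin n → ℕ
      mid# v = 𝟙 (σ v ≟ mid)
      -- The one vertex outside the separator whose count the crossing edge ab can raise beyond cov, y₁ and y₂.
      z : Fin n
      z = if does (covered? M b) then b else a
      z-b : Covered M b → z ≡ b
      z-b cb with covered? M b
      ... | yes _ = refl
      ... | no ¬c = ⊥-elim (¬c cb)
      z-a : U b → z ≡ a
      z-a ub with covered? M b
      ... | yes cb = ⊥-elim (ub cb)
      ... | no _   = refl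
      module At (v : Fin n) where
        M₂ C Y₁ Y₂ Z : ℕ
        M₂ = mid# v
        C  = cov v
        Y₁ = 𝟙 (y₁ ≟ v)
        Y₂ = 𝟙 (y₂ ≟ v)
        Z  = 𝟙 (z ≟ v)
        sort₁ : ∀ m c p q r → (c + p) + r ≤ m + m + c + p + q + r
        sort₁ m c p q r = ≤-trans (m≤m+n ((c + p) + r) (m + m + q)) (≤-reflexive (eq m c p q r))
          where
          eq : ∀ m c p q r → c + p + r + (m + m + q) ≡ m + m + c + p + q + r
          eq = solve-∀
        sort₂ : ∀ m c p q r → (r + p) + (c + q) ≤ m + m + c + p + q + r
        sort₂ m c p q r = ≤-trans (m≤m+n ((r + p) + (c + q)) (m + m)) (≤-reflexive (eq m c p q r))
          where
          eq : ∀ m c p q r → (r + p) + (c + q) + (m + m) ≡ m + m + c + p + q + r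
          eq = solve-∀
        by-cover : ∀ {c y} → (Covered M v → 1 ≤ c) → (U v → 1 ≤ y) → 1 ≤ c + y
        by-cover {c} {y} f g with covered? M v
        ... | yes cv = ≤-trans (f cv) (m≤m+n c y)
        ... | no uv  = ≤-trans (g uv) (m≤n+m y c)
      bound : ∀ v → adj u v + adj w′ v ≤ mid# v + mid# v + cov v + 𝟙 (y₁ ≟ v) + 𝟙 (y₂ ≟ v) + 𝟙 (z ≟ v)
      bound v = go (σ v) refl
        where
        open At v
        go : ∀ p → σ v ≡ p → adj u v + adj w′ v ≤ M₂ + M₂ + C + Y₁ + Y₂ + Z
        go mid e = ≤-trans (+-mono-≤ (≤-trans (≤1 (adj? G u v)) one) (≤-trans (≤1 (adj? G w′ v)) one))
          (≤-trans (m≤m+n (M₂ + M₂) (C + Y₁ + Y₂ + Z)) (≤-reflexive (eq M₂ C Y₁ Y₂ Z)))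
          where
          one : 1 ≤ M₂
          one = 1≤𝟙 (σ v ≟ mid) e
          eq : ∀ m c p q r → m + m + (c + p + q + r) ≡ m + m + c + p + q + r
          eq = solve-∀
        go left e = ≤-trans (+-mono-≤
          (𝟙≤ (adj? G u v) λ uv → by-cover (1≤𝟙 (covered? M v))
            λ Uv → 1≤𝟙 (y₁ ≟ v) (≡-sym (u-leaf v Uv (l≢m e) (U-adj uu uv))))
          (𝟙≤ (adj? G w′ v) λ w′v → 1≤𝟙 (z ≟ v) (from-right w′v)))
          (sort₁ M₂ C Y₁ Y₂ Z)
          where
          from-right : Adj G w′ v → z ≡ v
          from-right w′v with only v w′ (e , w′r , sym H (U-adj uw′ w′v))
          ... | refl , refl = z-a uw′
        go right e = ≤-trans (+-mono-≤
          (𝟙≤ (adj? G u v) λ uv → by-cover (λ cv → 1≤𝟙 (z ≟ v) (from-left uv cv))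
            λ Uv → 1≤𝟙 (y₁ ≟ v) (≡-sym (u-leaf v Uv (r≢m e) (U-adj uu uv))))
          (𝟙≤ (adj? G w′ v) λ w′v → by-cover (1≤𝟙 (covered? M v))
            λ Uv → 1≤𝟙 (y₂ ≟ v) (≡-sym (w′-leaf v (Uv , e) (U-adj uw′ w′v)))))
          (sort₂ M₂ C Y₁ Y₂ Z)
          where
          from-left : Adj G u v → Covered M v → z ≡ v
          from-left uv cv with only u v (ul , e , U-adj uu uv)
          ... | refl , refl = z-b cv

    -- A leaf of U minus the separator lies on one of the two sides; after a flip if necessary, it
    -- takes the role of u in `one-sided′`.
    one-sided : ∀ {a b σ} → Critical H k a b σ → ∀ {u w} → U u → U w → σ u ≡ left → σ w ≢ right
    one-sided {σ = σ} c {u} {w} uu uw ul wr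
      with leaf-in crit {W = λ v → U v × σ v ≢ mid} (λ v → U? v ×-dec ¬? (σ v ≟ mid)) proj₁
             (u , uu , l≢m ul)
    ... | ℓ , (uℓ , ℓ≢mid) , y , ℓ-leaf = go (σ ℓ) refl
      where
      go : ∀ p → σ ℓ ≡ p → ⊥
      go left  e = one-sided′ c uℓ e (λ v uv v≢mid → ℓ-leaf v (uv , v≢mid)) uw wr
      go mid   e = ℓ≢mid e
      go right e = one-sided′ (critical-flip c) uℓ (cong flip e)
        (λ v uv v≢mid → ℓ-leaf v (uv , λ m → v≢mid (cong flip m))) uu (cong flip ul)

    -- An edge inside U would be critical, with its two uncovered ends on opposite sides.
    independent : ∀ {u w} → U u → U w → ¬ Adj H u w
    independent uu uw a with crit _ _ uu uw a
    ... | σ , c = one-sided c uu uw (Critical.x-left c) (Critical.y-right c)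

    -- Let B be the right side, which contains x. It is covered by `one-sided`, as are the
    -- neighbours of u by independence, and the two sets share at most x: d(u) + |B| ≤ 2|M| + 1.
    -- Moreover x and its neighbours lie in B, in S, or among u and the partner of x: d(x) + 1 ≤ |B|
    -- + |S| + 2. Adding up gives 2k ≤ |S|, against |S| < k.
    uncritical : ∀ {u x σ} → U u → ¬ Critical H k u x σ
    uncritical {u} {x} {σ} uu c = 1+n≰n (+-cancelʳ-≤ R _ _ (begin
        suc (2 * j + 1 + (1 + m′ + 1)) + R         ≤⟨ m≤m+n _ (suc m′) ⟩
        suc (2 * j + 1 + (1 + m′ + 1)) + R + suc m′  ≡⟨ arith m′ j R ⟩
        (suc m′ + suc j + R) + (suc m′ + suc j + 1)  ≤⟨ +-mono-≤ (+-monoˡ-≤ R (+-monoˡ-≤ (suc j) small)) (+-monoˡ-≤ 1 (+-monoˡ-≤ (suc j) small)) ⟩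
        (k + suc j + R) + (k + suc j + 1)          ≤⟨ +-mono-≤ count-u count-x ⟩
        (2 * j + 1) + (R + m′ + 1 + 1)             ≡⟨ arith′ m′ j R ⟩
        2 * j + 1 + (1 + m′ + 1) + R ∎))
      where
      open ≤-Reasoning
      open Critical c
      m′ R : ℕ
      m′ = # mid σ
      R  = # right σ
      arith : ∀ s j r → suc (2 * j + 1 + (1 + s + 1)) + r + suc s ≡ (suc s + suc j + r) + (suc s + suc j + 1)
      arith = solve-∀
      arith′ : ∀ s j r → (2 * j + 1) + (r + s + 1 + 1) ≡ 2 * j + 1 + (1 + s + 1) + r
      arith′ = solve-∀
      right-covered : ∀ v → σ v ≡ right → 1 ≤ cov v
      right-covered v r with covered? M v
      ... | yes _ = ≤-refl
      ... | no uv = ⊥-elim (one-sided c uu uv x-left r)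
      count-u : k + suc j + R ≤ 2 * j + 1
      count-u = begin
        k + suc j + R                                      ≤⟨ +-monoˡ-≤ R (deg-sum u) ⟩
        sum (λ v → 𝟙 (adj? G u v)) + R                     ≡⟨ ∑-distrib-+ (λ v → 𝟙 (adj? G u v)) (λ v → 𝟙 (σ v ≟ right)) ⟨
        sum (λ v → 𝟙 (adj? G u v) + 𝟙 (σ v ≟ right))       ≤⟨ sum-mono bound ⟩
        sum (λ v → cov v + 𝟙 (x ≟ v))                      ≤⟨ sum-+-≤ n (sum-covered M) (≤-reflexive (sum-≟ x)) ⟩
        2 * j + 1 ∎
        where
        nbr-covered : ∀ v → Adj G u v → 1 ≤ cov v
        nbr-covered v uv with covered? M v
        ... | yes _ = ≤-refl
        ... | no Uv = ⊥-elim (independent uu Uv (U-adj uu uv))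
        bound : ∀ v → 𝟙 (adj? G u v) + 𝟙 (σ v ≟ right) ≤ cov v + 𝟙 (x ≟ v)
        bound v with σ v ≟ right
        -- Membership of v in B is paid for by `cov`, adjacency to u by the x-term.
        ... | yes r = ≤-trans (≤-reflexive (+-comm (𝟙 (adj? G u v)) 1)) (+-mono-≤ (right-covered v r)
                        (𝟙≤ (adj? G u v) λ uv → 1≤𝟙 (x ≟ v) (≡-sym (proj₂ (only u v (x-left , r , U-adj uu uv))))))
        ... | no _  = +-mono-≤ (𝟙≤ (adj? G u v) (nbr-covered v)) z≤n
      count-x : k + suc j + 1 ≤ R + m′ + 1 + 1
      count-x with partner matching x
      ... | p , partner-p = begin
        k + suc j + 1                                      ≤⟨ +-mono-≤ (deg-sum x) (≤-reflexive (≡-sym (sum-≟ x))) ⟩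
        sum (λ v → 𝟙 (adj? G x v)) + sum (λ v → 𝟙 (x ≟ v)) ≡⟨ ∑-distrib-+ (λ v → 𝟙 (adj? G x v)) (λ v → 𝟙 (x ≟ v)) ⟨
        sum (λ v → 𝟙 (adj? G x v) + 𝟙 (x ≟ v))             ≤⟨ sum-mono bound ⟩
        sum (λ v → 𝟙 (σ v ≟ right) + 𝟙 (σ v ≟ mid) + 𝟙 (u ≟ v) + 𝟙 (p ≟ v))
          ≤⟨ sum-+-≤ n (sum-+-≤ n (sum-+-≤ n ≤-refl ≤-refl) (≤-reflexive (sum-≟ u))) (≤-reflexive (sum-≟ p)) ⟩
        R + m′ + 1 + 1 ∎
        where
        bound : ∀ v → 𝟙 (adj? G x v) + 𝟙 (x ≟ v) ≤ 𝟙 (σ v ≟ right) + 𝟙 (σ v ≟ mid) + 𝟙 (u ≟ v) + 𝟙 (p ≟ v)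
        bound v with x ≟ v
        ... | yes refl = ≤-trans (≤-reflexive (cong (_+ 1) (𝟙-no (adj? G x x) (irrefl G refl))))
                (≤-trans (1≤𝟙 (σ x ≟ right) y-right) (≤-trans (m≤m+n _ (𝟙 (σ x ≟ mid))) (≤-trans (m≤m+n _ (𝟙 (u ≟ x))) (m≤m+n _ (𝟙 (p ≟ x))))))
        ... | no _ = ≤-trans (≤-reflexive (+-identityʳ _)) (𝟙≤ (adj? G x v) λ xv → go xv (σ v) refl)
          where
          go : Adj G x v → ∀ q → σ v ≡ q → 1 ≤ 𝟙 (σ v ≟ right) + 𝟙 (σ v ≟ mid) + 𝟙 (u ≟ v) + 𝟙 (p ≟ v)
          go xv right e = ≤-trans (1≤𝟙 (σ v ≟ right) e) (≤-trans (m≤m+n _ (𝟙 (σ v ≟ mid))) (≤-trans (m≤m+n _ (𝟙 (u ≟ v))) (m≤m+n _ (𝟙 (p ≟ v)))))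
          go xv mid   e = ≤-trans (1≤𝟙 (σ v ≟ mid) e) (≤-trans (m≤n+m _ (𝟙 (σ v ≟ right))) (≤-trans (m≤m+n _ (𝟙 (u ≟ v))) (m≤m+n _ (𝟙 (p ≟ v)))))
          go xv left  e with Any.any? (joins? x v) M
          ... | yes jn = ≤-trans (1≤𝟙 (p ≟ v) (partner-p v jn)) (m≤n+m _ (𝟙 (σ v ≟ right) + 𝟙 (σ v ≟ mid) + 𝟙 (u ≟ v)))
          ... | no ¬jn = ≤-trans (1≤𝟙 (u ≟ v) (≡-sym (proj₁ (only v x (e , y-right , sym H (xv , ¬jn))))))
                  (≤-trans (m≤n+m _ (𝟙 (σ v ≟ right) + 𝟙 (σ v ≟ mid))) (m≤m+n _ (𝟙 (p ≟ v))))

    -- Any separation of the new graph is crossed in H by `e₁` or `e₂` only. If just one of them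
    -- crossed, it would be critical, against `uncritical`; `both` excludes that they cross
    -- together.
    exchange : ∀ {u₁ u₂ x y e M′} → M ↭ e ∷ M′ → AllPairs Disjoint (e ∷ M′) → Joins x y e →
               U u₁ → U u₂ → u₁ ≢ u₂ → Adj G u₁ x → Adj G u₂ y → Adj G u₁ y ⊎ Adj G u₂ x → Extension
    exchange {u₁} {u₂} {x} {y} {e} {M′} perm (e∥M′ ∷ M′-disjoint) xy∈e U₁ U₂ u₁≢u₂ u₁x u₂y third =
      N , ((e₁∥e₂ ∷ fresh e₁ (λ { (inj₁ refl) → U₁ ∘ in-M ; (inj₂ refl) → x∉M′ }))
           ∷ fresh e₂ (λ { (inj₁ refl) → U₂ ∘ in-M ; (inj₂ refl) → y∉M′ })
           ∷ M′-disjoint , cong suc (≡-sym (↭-length perm))) ,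
      inseparable⇒kConnected (proj₁ removable) λ σ s → both σ s
        (find-crossing (λ a b → joins? a b e₂) (λ none → uncritical U₁ (proj₂ (separation⇒critical insep s λ a b c →
          [ joined e₁ , (λ j₂ → ⊥-elim (none (a , b , c , j₂))) ]′ (crossing-joined s c)))))
        (find-crossing (λ a b → joins? a b e₁) (λ none → uncritical U₂ (proj₂ (separation⇒critical insep s λ a b c →
          [ (λ j₁ → ⊥-elim (none (a , b , c , j₁))) , joined e₂ ]′ (crossing-joined s c)))))
      where
      e₁ e₂ : Edge G
      e₁ = edge u₁ x u₁x
      e₂ = edge u₂ y u₂y
      N : List (Edge G)
      N = e₁ ∷ e₂ ∷ M′
      in-M : ∀ {v} → Covered M′ v → Covered M v
      in-M c = Any-resp-↭ (↭-sym perm) (there c)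
      x∈e : x ∈ᵉ e
      x∈e = joins⇒∈ e xy∈e
      y∈e : y ∈ᵉ e
      y∈e = joins⇒∈ e (joins-swap e xy∈e)
      x∈M : Covered M x
      x∈M = Any-resp-↭ (↭-sym perm) (here x∈e)
      y∈M : Covered M y
      y∈M = Any-resp-↭ (↭-sym perm) (here y∈e)
      x∉M′ : ¬ Covered M′ x
      x∉M′ = disjoint⇒uncovered {e = e} e∥M′ x∈e
      y∉M′ : ¬ Covered M′ y
      y∉M′ = disjoint⇒uncovered {e = e} e∥M′ y∈e
      adj-e : ∀ (f : Edge G) {a b} → Joins a b f → Adj G a b
      adj-e f (inj₁ (refl , refl)) = adjacent f
      adj-e f (inj₂ (refl , refl)) = sym G (adjacent f)
      x~y : Adj G x y
      x~y = adj-e e xy∈e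
      e₁∥e₂ : Disjoint e₁ e₂
      e₁∥e₂ v (inj₁ refl , inj₁ refl) = u₁≢u₂ refl
      e₁∥e₂ v (inj₁ refl , inj₂ refl) = U₁ y∈M
      e₁∥e₂ v (inj₂ refl , inj₁ refl) = U₂ x∈M
      e₁∥e₂ v (inj₂ refl , inj₂ refl) = irrefl G refl x~y
      fresh : ∀ f → (∀ {v} → v ∈ᵉ f → ¬ Covered M′ v) → All (Disjoint f) M′
      fresh f unc = All.tabulate λ {g} g∈M′ v (v∈f , v∈g) → unc v∈f (Any.map (λ { refl → v∈g }) g∈M′)
      joined : ∀ (f : Edge G) {a b} → Joins a b f → (a ≡ src f × b ≡ tgt f) ⊎ (a ≡ tgt f × b ≡ src f)
      joined f (inj₁ (refl , refl)) = inj₁ (refl , refl)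
      joined f (inj₂ (refl , refl)) = inj₂ (refl , refl)

      -- Stated for edges of G rather than H, because xy belongs to M and is absent from H, yet must
      -- be seen to cross.
      Cut : Colouring n → Set
      Cut σ = ∀ a b → σ a ≡ left → σ b ≡ right → Adj G a b → Any (Joins a b) N

      cut : ∀ {σ} → Separation (deleteEdges G N) k σ → Cut σ
      cut s a b al br ab with Any.any? (joins? a b) N
      ... | yes j = j
      ... | no ¬j = ⊥-elim (Separation.separates s a b (al , br , ab , ¬j))

      cut-flip : ∀ {σ} → Cut σ → Cut (flip ∘ σ)
      cut-flip c a b al br ab = Any.map (λ {f} → joins-swap f) (c b a (flip-right _ br) (flip-left _ al) (sym G ab))

      crossing-joined : ∀ {σ a b} → Separation (deleteEdges G N) k σ → Crosses H σ a b → Joins a b e₁ ⊎ Joins a b e₂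
      crossing-joined s (al , br , ab , ¬M) with cut s _ _ al br ab
      ... | here j₁          = inj₁ j₁
      ... | there (here j₂)  = inj₂ j₂
      ... | there (there j′) = ⊥-elim (¬M (Any-resp-↭ (↭-sym perm) (there j′)))

      Ends : Colouring n → Fin n → Fin n → Set
      Ends σ a b = (σ a ≡ left × σ b ≡ right) ⊎ (σ a ≡ right × σ b ≡ left)

      -- The search is finite, so refuting the absence of a crossing edge produces one.
      find-crossing : ∀ {σ} {J : Fin n → Fin n → Set} → (∀ a b → Dec (J a b)) →
               ¬ ¬ (∃₂ λ a b → Crosses H σ a b × J a b) → ∃₂ λ a b → Crosses H σ a b × J a b
      find-crossing {σ} J? ¬¬c with any? (λ a → any? λ b → crosses? H σ a b ×-dec J? a b)
      ... | yes c = c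
      ... | no ¬c = ⊥-elim (¬¬c ¬c)

      -- If both u₁x and u₂y crossed, so would xy or the third edge, neither of which is in N.
      third-uncut : ∀ {σ} → Cut σ → σ u₁ ≡ left → σ x ≡ right → σ u₂ ≡ left → σ y ≡ right →
                    ¬ (Adj G u₁ y ⊎ Adj G u₂ x)
      third-uncut c u₁l xr u₂l yr (inj₁ u₁y) with c u₁ y u₁l yr u₁y
      ... | here (inj₁ (_ , refl))         = irrefl G refl x~y
      ... | here (inj₂ (refl , _))         = U₁ y∈M
      ... | there (here (inj₁ (refl , _))) = u₁≢u₂ refl
      ... | there (here (inj₂ (refl , _))) = U₂ y∈M
      ... | there (there j)                = U₁ (in-M (joined⇒covered j))
      third-uncut c u₁l xr u₂l yr (inj₂ u₂x) with c u₂ x u₂l xr u₂x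
      ... | here (inj₁ (refl , _))         = u₁≢u₂ refl
      ... | here (inj₂ (refl , _))         = U₁ x∈M
      ... | there (here (inj₁ (_ , refl))) = irrefl G refl x~y
      ... | there (here (inj₂ (refl , _))) = U₂ x∈M
      ... | there (there j)                = U₂ (in-M (joined⇒covered j))

      uncut : ∀ {σ} → Cut σ → σ u₁ ≡ left → σ x ≡ right → ¬ Ends σ u₂ y
      uncut c u₁l xr (inj₁ (u₂l , yr)) = third-uncut c u₁l xr u₂l yr third
      -- The two new edges cross in opposite directions, which puts x and y on different sides.
      uncut c u₁l xr (inj₂ (u₂r , yl)) with c y x yl xr (sym G x~y)
      ... | here (inj₁ (refl , _))         = U₁ y∈M
      ... | here (inj₂ (refl , _))         = U₁ x∈M
      ... | there (here (inj₁ (refl , _))) = U₂ y∈M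
      ... | there (here (inj₂ (refl , _))) = U₂ x∈M
      ... | there (there j)                = y∉M′ (joined⇒covered j)

      ends : ∀ {σ a b} (f : Edge G) → Crosses H σ a b → Joins a b f → Ends σ (src f) (tgt f)
      ends f (al , br , _) (inj₁ (refl , refl)) = inj₁ (al , br)
      ends f (al , br , _) (inj₂ (refl , refl)) = inj₂ (br , al)

      both : ∀ σ → Separation (deleteEdges G N) k σ → (∃₂ λ a b → Crosses H σ a b × Joins a b e₂) →
             (∃₂ λ a b → Crosses H σ a b × Joins a b e₁) → ⊥
      both σ s (_ , _ , c₂ , j₂) (_ , _ , c₁ , j₁) with ends e₁ c₁ j₁ | ends e₂ c₂ j₂
      ... | inj₁ (u₁l , xr) | E = uncut (cut s) u₁l xr E
      ... | inj₂ (u₁r , xl) | inj₁ (p , q) = uncut (cut-flip (cut s)) (cong flip u₁r) (cong flip xl) (inj₂ (cong flip p , cong flip q))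
      ... | inj₂ (u₁r , xl) | inj₂ (p , q) = uncut (cut-flip (cut s)) (cong flip u₁r) (cong flip xl) (inj₁ (cong flip p , cong flip q))

    exchangeable : ∀ {u₁ u₂} → U u₁ → U u₂ → u₁ ≢ u₂ → Extension
    exchangeable {u₁} {u₂} U₁ U₂ u₁≢u₂ with extract (λ {e} {f} → Disjoint-sym {x = e} {f}) (heavy-edge f M many) matching
      where
      open ≤-Reasoning
      f : Fin n → ℕ
      f v = 𝟙 (adj? G u₁ v) + 𝟙 (adj? G u₂ v)
      many : 2 * j < ∑ᴱ f M
      many = begin-strict
        2 * j                        <⟨ m<m+n (2 * j) {2 + (k + k)} (s≤s z≤n) ⟩
        2 * j + (2 + (k + k))        ≡⟨ arith j k ⟩
        (k + suc j) + (k + suc j)    ≤⟨ +-mono-≤ (deg-sum u₁) (deg-sum u₂) ⟩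
        sum (λ v → 𝟙 (adj? G u₁ v)) + sum (λ v → 𝟙 (adj? G u₂ v)) ≡⟨ ∑-distrib-+ (λ v → 𝟙 (adj? G u₁ v)) (λ v → 𝟙 (adj? G u₂ v)) ⟨
        sum f                        ≤⟨ sum≤∑ᴱ f M (λ v Uv → cong₂ _+_ (𝟙-no (adj? G u₁ v) (independent U₁ Uv ∘ U-adj U₁))
                                                                       (𝟙-no (adj? G u₂ v) (independent U₂ Uv ∘ U-adj U₂))) ⟩
        ∑ᴱ f M ∎
        where
        arith : ∀ j k → 2 * j + (2 + (k + k)) ≡ (k + suc j) + (k + suc j)
        arith = solve-∀
    ... | e , M′ , heavy , disjoint , perm
      with adj? G u₁ (src e) | adj? G u₂ (src e) | adj? G u₁ (tgt e) | adj? G u₂ (tgt e)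
    -- Among three edges from u₁ and u₂ to the ends of e, two are disjoint; the other one is passed
    -- as the third edge.
    ... | yes u₁s | _       | yes u₁t | yes u₂t = exchange perm disjoint (inj₁ (refl , refl)) U₁ U₂ u₁≢u₂ u₁s u₂t (inj₁ u₁t)
    ... | yes u₁s | yes u₂s | no _    | yes u₂t = exchange perm disjoint (inj₁ (refl , refl)) U₁ U₂ u₁≢u₂ u₁s u₂t (inj₂ u₂s)
    ... | yes u₁s | yes u₂s | yes u₁t | no _    = exchange perm disjoint (inj₂ (refl , refl)) U₁ U₂ u₁≢u₂ u₁t u₂s (inj₁ u₁s)
    ... | no _    | yes u₂s | yes u₁t | yes u₂t = exchange perm disjoint (inj₂ (refl , refl)) U₁ U₂ u₁≢u₂ u₁t u₂s (inj₂ u₂t)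
    -- The remaining cases have at most two edges, against `heavy`.
    ... | yes _   | yes _   | no _    | no _    with s≤s (s≤s ()) ← heavy
    ... | yes _   | no _    | yes _   | no _    with s≤s (s≤s ()) ← heavy
    ... | yes _   | no _    | no _    | yes _   with s≤s (s≤s ()) ← heavy
    ... | yes _   | no _    | no _    | no _    with s≤s () ← heavy
    ... | no _    | yes _   | yes _   | no _    with s≤s (s≤s ()) ← heavy
    ... | no _    | yes _   | no _    | yes _   with s≤s (s≤s ()) ← heavy
    ... | no _    | yes _   | no _    | no _    with s≤s () ← heavy
    ... | no _    | no _    | yes _   | yes _   with s≤s (s≤s ()) ← heavy
    ... | no _    | no _    | yes _   | no _    with s≤s () ← heavy
    ... | no _    | no _    | no _    | yes _   with s≤s () ← heavy
    ... | no _    | no _    | no _    | no _    with () ← heavy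

-- Induction on the size of the matching.

grow-matching : ∀ {n k} {G : Graph (Fin n)} m →
  (∀ {M} → length M < m → AllPairs Disjoint M → IsRemovable k G M →
     ∃ λ (M′ : List (Edge G)) → IsMatching (suc (length M)) M′ × IsRemovable k G M′) →
  IsKConnected k G → ∃ λ (M : List (Edge G)) → IsMatching m M × IsRemovable k G M
grow-matching {G = G} zero step conn@(k<n , _) =
  -- Deleting no edges gives G only up to equivalence of adjacency, so connectivity is carried over
  -- through separations.
  [] , ([] , refl) , inseparable⇒kConnected {G = deleteEdges G []} k<n λ σ (separation l r s c) →
    kConnected⇒inseparable {G = G} conn σ (separation l r s λ u v (ul , vr , uv) → c u v (ul , vr , uv , λ ()))
grow-matching (suc m) step conn with grow-matching m (step ∘ m<n⇒m<1+n) conn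
... | M , (matching , refl) , removable = step ≤-refl matching removable

-- The two branches of the degree condition, in the form in which the augmentation uses them.
HighDegree : ∀ {n} → ℕ → ℕ → Graph (Fin n) → Set
HighDegree k m G = (∀ u → k < degree G u × 2 * m ≤ degree G u) ⊎ (∀ u → k + m ≤ degree G u)

augment : ∀ {n k m} {G : Graph (Fin (suc n))} → suc n ≥ 2 * m → HighDegree k m G →
  ∀ {M} → length M < m → AllPairs Disjoint M → IsRemovable k G M →
  ∃ λ (M′ : List (Edge G)) → IsMatching (suc (length M)) M′ × IsRemovable k G M′
augment {n} {k} {m} {G} n≥2m high {M} j<m matching removable = by-degree high
  where
  2j+1<2m : 2 * length M + 1 < 2 * m
  2j+1<2m = ≤-trans (≤-reflexive (arith (length M))) (*-monoʳ-≤ 2 j<m)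
    where
    arith : ∀ j → suc (2 * j + 1) ≡ 2 * suc j
    arith = solve-∀

  by-degree : HighDegree k m G → ∃ λ (M′ : List (Edge G)) → IsMatching (suc (length M)) M′ × IsRemovable k G M′
  by-degree (inj₁ deg) = [ id , (λ crit → ⊥-elim (few-neighbours crit)) ]′ extend-or-critical
    where
    open Step matching removable (proj₁ ∘ deg)
    few-neighbours : ¬ AllCritical
    few-neighbours crit =
      -- Some uncovered vertex is wanted here, so the vertex to avoid is chosen arbitrarily.
      let (u , uu , _) = uncovered-other (<-≤-trans 2j+1<2m n≥2m) zero
          (w , small)  = leaf-degree crit (u , uu)
      in <⇒≱ 2j+1<2m (≤-trans (proj₂ (deg w)) small)
  by-degree (inj₂ deg) = [ id , from-exchange ]′ extend-or-critical
    where
    open Exchange matching removable (λ u → ≤-trans (+-monoʳ-≤ k j<m) (deg u))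
    from-exchange : AllCritical → Extension
    from-exchange crit =
      let (u₁ , U₁ , _)    = uncovered-other (<-≤-trans 2j+1<2m n≥2m) zero
          (u₂ , U₂ , u₂≢u₁) = uncovered-other (<-≤-trans 2j+1<2m n≥2m) u₁
      in exchangeable crit U₁ U₂ (u₂≢u₁ ∘ ≡-sym)

theorem1p7 : ∀ (k m : ℕ) → k ≥ 1 → m ≥ 1 →
    ∀ (n : ℕ) (G : Graph (Fin n)) →
    IsKConnected k G →
    n ≥ 2 * m →
    δ G ≥ (if m ≤ᵇ k then (k + ⌈ m /2⌉) ⊔ (2 * m) else k + m) →
    ∃ λ (M : List (Edge G)) → IsMatching m M × IsRemovable k G M
theorem1p7 k (suc m) _ _ (suc n) G conn n≥2m δ≥ = grow-matching (suc m) (augment n≥2m (high (suc m ≤ᵇ k) δ≥)) conn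
  where
  -- Abstracting the test to a Boolean lets the `if` in the hypothesis reduce.
  high : ∀ b → δ G ≥ (if b then (k + ⌈ suc m /2⌉) ⊔ (2 * suc m) else k + suc m) → HighDegree k (suc m) G
  high true  δ≥ = inj₁ λ u →
    -- The rounded-up half is positive, which makes the bound on k strict.
    ≤-trans (m<m+n k (s≤s z≤n)) (≤-trans (m≤m⊔n _ _) (≤-trans δ≥ (δ≤degree G u))) ,
    ≤-trans (m≤n⊔m (k + ⌈ suc m /2⌉) _) (≤-trans δ≥ (δ≤degree G u))
  high false δ≥ = inj₂ λ u → ≤-trans δ≥ (δ≤degree G u)
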